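{- For every $s\geqslant0$ and every formula $\psi$ of $BT_s$: if $BT_s^{cl}\vdash\psi$, then $BT_s\vdash\psi^-$.
   Context: $BT$ is the many-typed applicative theory with intuitionistic logic defined as follows. Types $\omega$ and $k\geqslant0$ ($\omega$ smallest). Variables: numerical $m,n,\ldots$ (type $\omega$), $X^k,Y^k,Z^k,\ldots$ of type $k$; type-$0$ variables also written $x,y,z,f,g,u,v$. Constants: $0$ (numerical), type-0 constants $\underline{k},\underline{s},\underline{d},\underline{p},\underline{p}_1,\underline{p}_2,\underline{c}_n$ $(n\geqslant0)$. No function symbols. Predicates: $Ap(f,x,y)$, $x=_{0\omega}m$, $x=_{0k}Y^k$, $X^k\in_kY^{k+1}$. Formulas built from atomic ones and $\bot$ by $\wedge,\vee,\supset,\forall,\exists$; $\neg\varphi:=\varphi\supset\bot$. A formula is $n$-elementary if it contains only types $\leqslant n$, no quantifier over type-$n$ variables and no $=_{0n}$. External terms: constants, variables, and applications $t\tau$ (left-associated). $t\simeq x$ is $x=_{0s}t$ for $t$ a constant/variable of type $s$, and $\exists y,z(t_1\simeq y\wedge t_2\simeq z\wedge Ap(y,z,x))$ for $t=t_1t_2$; $t\downarrow:=\exists x(t\simeq x)$, $t\simeq\tau:=\exists x(t\simeq x\wedge\tau\simeq x)$, $t\cong\tau:=\forall x(t\simeq x\equiv\tau\simeq x)$; $\tau(t_1,\ldots,t_n)$ means $\tau\langle t_1,\ldots,t_n\rangle$ with $\langle x_1\rangle=x_1$, $\langle x_1,\ldots,x_{n+1}\rangle=\underline{p}\langle x_1,\ldots,x_n\rangle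 x_{n+1}$. Axioms: (1) intuitionistic logic; (2) equality: $x=_{00}x$; $u=_{0k}X^k\wedge v=_{0k}X\wedge u=_{0n}Y^n\supset v=_{0n}Y$; $u=_{0\omega}m\wedge v=_{0\omega}m\supset u=_{00}v$; $u=_{0\omega}m\wedge u=_{00}v\supset v=_{0\omega}m$; $Ap(f,x,y)\wedge f=_{00}g\wedge x=_{00}u\wedge y=_{00}v\supset Ap(g,u,v)$; $X^k\in_kY^{k+1}\wedge X^k=_kU^k\wedge Y^{k+1}=_{k+1}Z^{k+1}\supset U\in_kZ$; (3) combinatorial: $Ap(f,x,y)\wedge Ap(f,x,z)\supset y=z$; $\underline{k}xy\simeq x$; $\underline{s}xy\downarrow$; $\underline{s}xyz\cong xz(yz)$; $\underline{p}xy\downarrow$; $\neg(\underline{p}xy\simeq0)$; $\underline{p}_ix\downarrow$; $\underline{p}_i(\underline{p}x_1x_2)\simeq x_i$; $\exists m(\underline{p}n0\simeq m)$; $\exists Z^k(\underline{p}xY^k\simeq Z)$; $n=m\supset\underline{d}xynm\simeq x$; $n\neq m\supset\underline{d}xynm\simeq y$; $\exists x(x=_{0\omega}n)$; $\exists x(x=_{0k}Y^k)$; (4) induction rule: from $\varphi[n/0]$ and $\varphi\supset\exists m(\underline{p}n0\simeq m\wedge\varphi[n/m])$ infer $\varphi$; (5) comprehension: $\exists U^{k+1}[\underline{c}_n(\widetilde X)\simeq U\wedge\forall Z^k(Z\in_kU\equiv\varphi)]$ for $\widetilde X$ a list of variables of types $\leqslant k+1$, $\varphi$ $(k+1)$-elementary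 with parameters among $Z^k,\widetilde X$, and $n$ the Gödel number of $Z^k.\widetilde X.\varphi$. $BT_s$ is the fragment with types $\leqslant s$ only; $BT_s^{cl}$ is $BT_s$ with classical logic. Negative translation $^-$ (defined by simultaneous induction on Gödel numbers): for every constant $a$ other than a comprehension constant, $a^-:=a$. For a comprehension constant $\underline{c}_n$: if $n=\llcorner Z^k.\widetilde X.\varphi\lrcorner$ then $\underline{c}_n^-:=\underline{c}_{n^- }$ with $n^-:=\llcorner Z^k.\widetilde X.\varphi^-\lrcorner$; otherwise $\underline{c}_n^-:=0$. For formulas: if $\varphi$ is atomic, $\varphi^-:=\neg\neg\tilde\varphi$ where $\tilde\varphi$ replaces each constant $a$ by $a^-$; $\bot^-:=\bot$; $(\psi\wedge\chi)^-:=\psi^-\wedge\chi^-$; $(\psi\supset\chi)^-:=\psi^-\supset\chi^-$; $(\psi\vee\chi)^-:=\neg\neg(\psi^-\vee\chi^-)$; $(\forall X\psi)^-:=\forall X\psi^-$; $(\exists X\psi)^-:=\neg\neg\exists X\psi^-$ for a variable $X$ of any type. -}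

module Defs where

open import Data.Nat using (ℕ; zero; suc; _⊔_; _<_; _≤ᵇ_; _≡ᵇ_)
open import Data.Bool using (Bool; true; false; _∧_; _∨_; not; if_then_else_; T)
open import Data.Product using (_×_; _,_; proj₁; proj₂; Σ)
open import Data.List using (List; []; _∷_; foldr)
open import Data.List.Relation.Unary.All using (All)
open import Data.List.Membership.Propositional using (_∈_)
open import Data.Maybe using (Maybe; just; nothing)
open import Relation.Binary.PropositionalEquality using (_≡_; refl)
open import Relation.Nullary using (Dec; yes; no; ¬_)
open import Relation.Nullary.Decidable using (⌊_⌋)

data Ty : Set where
  ω  : Ty
  tp : ℕ → Ty

tp-inj : ∀ {m n} → tp m ≡ tp n → m ≡ n
tp-inj refl = refl

_≟Ty_ : (a b : Ty) → Dec (a ≡ b)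
ω ≟Ty ω = yes refl
ω ≟Ty tp _ = no (λ ())
tp _ ≟Ty ω = no (λ ())
tp m ≟Ty tp n with m Data.Nat.≟ n
... | yes refl = yes refl
... | no ne = no (λ e → ne (tp-inj e))

Var : Set
Var = Ty × ℕ

sameVar : Ty → ℕ → Ty → ℕ → Bool
sameVar s i s' j = ⌊ s ≟Ty s' ⌋ ∧ (i ≡ᵇ j)

-- Constants of type 0: k, s, d, p, p1, p2, c_n.  The numerical constant 0
-- is the term 'zer' of type ω.

data Const : Set where
  kc sc dc pc p1c p2c : Const
  cc : ℕ → Const

data Term : Ty → Set where
  var : {s : Ty} → ℕ → Term s
  con : Const → Term (tp 0)
  zer : Term ω

infixr 6 _∧'_
infixr 5 _∨'_
infixr 4 _⊃_

data Formula : Set where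
  Ap   : Term (tp 0) → Term (tp 0) → Term (tp 0) → Formula
  Eq0  : (s : Ty) → Term (tp 0) → Term s → Formula
  Mem  : (k : ℕ) → Term (tp k) → Term (tp (suc k)) → Formula
  ⊥'   : Formula
  _∧'_ : Formula → Formula → Formula
  _∨'_ : Formula → Formula → Formula
  _⊃_  : Formula → Formula → Formula
  ∀'   : Ty → ℕ → Formula → Formula
  ∃'   : Ty → ℕ → Formula → Formula

¬'_ : Formula → Formula
¬' φ = φ ⊃ ⊥'

_⇔_ : Formula → Formula → Formula
φ ⇔ ψ = (φ ⊃ ψ) ∧' (ψ ⊃ φ)

maxT : {s : Ty} → Term s → ℕ
maxT (var i) = i
maxT (con _) = 0
maxT zer = 0

maxF : Formula → ℕ
maxF (Ap a b c) = maxT a ⊔ maxT b ⊔ maxT c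
maxF (Eq0 _ a b) = maxT a ⊔ maxT b
maxF (Mem _ a b) = maxT a ⊔ maxT b
maxF ⊥' = 0
maxF (φ ∧' ψ) = maxF φ ⊔ maxF ψ
maxF (φ ∨' ψ) = maxF φ ⊔ maxF ψ
maxF (φ ⊃ ψ) = maxF φ ⊔ maxF ψ
maxF (∀' _ i φ) = i ⊔ maxF φ
maxF (∃' _ i φ) = i ⊔ maxF φ

maxVars : List Var → ℕ
maxVars = foldr (λ v m → proj₂ v ⊔ m) 0

occT : (s : Ty) → ℕ → {s' : Ty} → Term s' → Bool
occT s i {s'} (var j) = sameVar s i s' j
occT s i (con _) = false
occT s i zer = false

isFree : Ty → ℕ → Formula → Bool
isFree s i (Ap a b c) = occT s i a ∨ occT s i b ∨ occT s i c
isFree s i (Eq0 _ a b) = occT s i a ∨ occT s i b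
isFree s i (Mem _ a b) = occT s i a ∨ occT s i b
isFree s i ⊥' = false
isFree s i (φ ∧' ψ) = isFree s i φ ∨ isFree s i ψ
isFree s i (φ ∨' ψ) = isFree s i φ ∨ isFree s i ψ
isFree s i (φ ⊃ ψ) = isFree s i φ ∨ isFree s i ψ
isFree s i (∀' s' j φ) = if sameVar s' j s i then false else isFree s i φ
isFree s i (∃' s' j φ) = if sameVar s' j s i then false else isFree s i φ

substT : (s : Ty) → ℕ → Term s → {s' : Ty} → Term s' → Term s'
substT s i t {s'} (var j) with s ≟Ty s'
... | yes refl = if i ≡ᵇ j then t else var j
... | no _ = var j
substT s i t (con c) = con c
substT s i t zer = zer

-- φ[(s,i) := t]  (replaces free occurrences; used only under 'freeFor')
subst : (s : Ty) → ℕ → Term s → Formula → Formula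
subst s i t (Ap a b c) = Ap (substT s i t a) (substT s i t b) (substT s i t c)
subst s i t (Eq0 r a b) = Eq0 r (substT s i t a) (substT s i t b)
subst s i t (Mem k a b) = Mem k (substT s i t a) (substT s i t b)
subst s i t ⊥' = ⊥'
subst s i t (φ ∧' ψ) = subst s i t φ ∧' subst s i t ψ
subst s i t (φ ∨' ψ) = subst s i t φ ∨' subst s i t ψ
subst s i t (φ ⊃ ψ) = subst s i t φ ⊃ subst s i t ψ
subst s i t (∀' s' j φ) = if sameVar s' j s i then ∀' s' j φ else ∀' s' j (subst s i t φ)
subst s i t (∃' s' j φ) = if sameVar s' j s i then ∃' s' j φ else ∃' s' j (subst s i t φ)

freeFor : (s : Ty) → ℕ → Term s → Formula → Bool
freeFor s i t (φ ∧' ψ) = freeFor s i t φ ∧ freeFor s i t ψ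
freeFor s i t (φ ∨' ψ) = freeFor s i t φ ∧ freeFor s i t ψ
freeFor s i t (φ ⊃ ψ) = freeFor s i t φ ∧ freeFor s i t ψ
freeFor s i t (∀' s' j φ) =
  if sameVar s' j s i then true
  else ((not (isFree s i φ) ∨ not (occT s' j t)) ∧ freeFor s i t φ)
freeFor s i t (∃' s' j φ) =
  if sameVar s' j s i then true
  else ((not (isFree s i φ) ∨ not (occT s' j t)) ∧ freeFor s i t φ)
freeFor s i t _ = true

tyOK : ℕ → Ty → Bool
tyOK n ω = true
tyOK n (tp k) = k ≤ᵇ n

-- φ contains only types ≤ n  (φ is a formula of BT_n)
typesOK : ℕ → Formula → Bool
typesOK n (Ap _ _ _) = true
typesOK n (Eq0 s _ _) = tyOK n s
typesOK n (Mem k _ _) = suc k ≤ᵇ n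
typesOK n ⊥' = true
typesOK n (φ ∧' ψ) = typesOK n φ ∧ typesOK n ψ
typesOK n (φ ∨' ψ) = typesOK n φ ∧ typesOK n ψ
typesOK n (φ ⊃ ψ) = typesOK n φ ∧ typesOK n ψ
typesOK n (∀' s _ φ) = tyOK n s ∧ typesOK n φ
typesOK n (∃' s _ φ) = tyOK n s ∧ typesOK n φ

isTp : ℕ → Ty → Bool
isTp n s = ⌊ s ≟Ty tp n ⌋

elementary : ℕ → Formula → Bool
elementary n (Ap _ _ _) = true
elementary n (Eq0 s _ _) = tyOK n s ∧ not (isTp n s)
elementary n (Mem k _ _) = suc k ≤ᵇ n
elementary n ⊥' = true
elementary n (φ ∧' ψ) = elementary n φ ∧ elementary n ψ
elementary n (φ ∨' ψ) = elementary n φ ∧ elementary n ψ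
elementary n (φ ⊃ ψ) = elementary n φ ∧ elementary n ψ
elementary n (∀' s _ φ) = tyOK n s ∧ not (isTp n s) ∧ elementary n φ
elementary n (∃' s _ φ) = tyOK n s ∧ not (isTp n s) ∧ elementary n φ

constsT : {s : Ty} → Term s → List ℕ
constsT (con (cc m)) = m ∷ []
constsT _ = []

constsF : Formula → List ℕ
constsF (Ap a b c) = constsT a Data.List.++ constsT b Data.List.++ constsT c
constsF (Eq0 _ a b) = constsT a Data.List.++ constsT b
constsF (Mem _ a b) = constsT a Data.List.++ constsT b
constsF ⊥' = []
constsF (φ ∧' ψ) = constsF φ Data.List.++ constsF ψ
constsF (φ ∨' ψ) = constsF φ Data.List.++ constsF ψ
constsF (φ ⊃ ψ) = constsF φ Data.List.++ constsF ψ
constsF (∀' _ _ φ) = constsF φ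
constsF (∃' _ _ φ) = constsF φ

infixl 9 _·_

data ETerm : Set where
  atm : {s : Ty} → Term s → ETerm
  _·_ : ETerm → ETerm → ETerm

maxE : ETerm → ℕ
maxE (atm t) = maxT t
maxE (t · u) = maxE t ⊔ maxE u

-- t ≃ x  for a type-0 variable x (given by its name); bound variables fresh
_≃_ : ETerm → ℕ → Formula
atm {s} t ≃ x = Eq0 s (var x) t
(t₁ · t₂) ≃ x =
  let y = suc (maxE t₁ ⊔ maxE t₂ ⊔ x) ; z = suc y in
  ∃' (tp 0) y (∃' (tp 0) z
    ((t₁ ≃ y) ∧' ((t₂ ≃ z) ∧' Ap (var y) (var z) (var x))))

fresh2 : ETerm → ETerm → ℕ
fresh2 t τ = suc (maxE t ⊔ maxE τ)

_≃ₑ_ : ETerm → ETerm → Formula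
t ≃ₑ τ = ∃' (tp 0) (fresh2 t τ) ((t ≃ fresh2 t τ) ∧' (τ ≃ fresh2 t τ))

_↓ : ETerm → Formula
t ↓ = ∃' (tp 0) (suc (maxE t)) (t ≃ suc (maxE t))

_≅_ : ETerm → ETerm → Formula
t ≅ τ = ∀' (tp 0) (fresh2 t τ) ((t ≃ fresh2 t τ) ⇔ (τ ≃ fresh2 t τ))

EqT : (s : Ty) → Term s → Term s → Formula
EqT s A B = ∃' (tp 0) w (Eq0 s (var w) A ∧' Eq0 s (var w) B)
  where w = suc (maxT A ⊔ maxT B)

v0 : ℕ → ETerm
v0 x = atm (var {tp 0} x)

cst : Const → ETerm
cst a = atm (con a)

varE : Var → ETerm
varE (s , i) = atm (var {s} i)

-- τ(t₁,…,tₙ) = τ⟨t₁,…,tₙ⟩ ,  ⟨x₁⟩ = x₁ , ⟨x₁…xₙ₊₁⟩ = p⟨x₁…xₙ⟩xₙ₊₁ ;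
-- for the empty list, τ() := τ.
tupleFrom : ETerm → List Var → ETerm
tupleFrom acc [] = acc
tupleFrom acc (x ∷ xs) = tupleFrom (cst pc · acc · varE x) xs

applyTuple : ETerm → List Var → ETerm
applyTuple τ [] = τ
applyTuple τ (x ∷ xs) = τ · tupleFrom (varE x) xs

-- Gödel numbering of triples  Z^k . X̃ . φ   (k, name of Z, X̃, φ)

Triple : Set
Triple = ℕ × ℕ × List Var × Formula

record GodelNumbering : Set where
  field
    code        : Triple → ℕ
    decode      : ℕ → Maybe Triple
    decode-code : ∀ t → decode (code t) ≡ just t
    code-decode : ∀ n t → decode n ≡ just t → code t ≡ n
    code-bound  : ∀ k i X φ → All (_< code (k , i , X , φ)) (constsF φ)

data Logic : Set where
  int cl : Logic

module BT (G : GodelNumbering) where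
  open GodelNumbering G

  compAx : ℕ → ℕ → List Var → Formula → Formula
  compAx k i X φ =
    ∃' (tp (suc k)) u
      ((applyTuple (cst (cc (code (k , i , X , φ)))) X ≃ₑ atm (var {tp (suc k)} u))
       ∧' ∀' (tp k) i (Mem k (var i) (var u) ⇔ φ))
    where u = suc (maxF φ ⊔ maxVars X ⊔ i)

  data Axiom (L : Logic) : Formula → Set where
    lk   : ∀ φ ψ → Axiom L (φ ⊃ ψ ⊃ φ)
    ls   : ∀ φ ψ χ → Axiom L ((φ ⊃ ψ) ⊃ (φ ⊃ ψ ⊃ χ) ⊃ φ ⊃ χ)
    land1 : ∀ φ ψ → Axiom L (φ ∧' ψ ⊃ φ)
    land2 : ∀ φ ψ → Axiom L (φ ∧' ψ ⊃ ψ)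
    land3 : ∀ φ ψ → Axiom L (φ ⊃ ψ ⊃ φ ∧' ψ)
    lor1 : ∀ φ ψ → Axiom L (φ ⊃ φ ∨' ψ)
    lor2 : ∀ φ ψ → Axiom L (ψ ⊃ φ ∨' ψ)
    lor3 : ∀ φ ψ χ → Axiom L ((φ ⊃ χ) ⊃ (ψ ⊃ χ) ⊃ φ ∨' ψ ⊃ χ)
    lbot : ∀ φ → Axiom L (⊥' ⊃ φ)
    lall : ∀ s i φ (t : Term s) → T (freeFor s i t φ) →
           Axiom L (∀' s i φ ⊃ subst s i t φ)
    lex  : ∀ s i φ (t : Term s) → T (freeFor s i t φ) →
           Axiom L (subst s i t φ ⊃ ∃' s i φ)
    lem  : L ≡ cl → ∀ φ → Axiom L (φ ∨' ¬' φ)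
    e-refl : ∀ x → Axiom L (Eq0 (tp 0) (var x) (var x))
    e-name : ∀ k n u v X Y →
      Axiom L (Eq0 (tp k) (var u) (var X) ∧' Eq0 (tp k) (var v) (var X) ∧' Eq0 (tp n) (var u) (var Y)
               ⊃ Eq0 (tp n) (var v) (var Y))
    e-num1 : ∀ u v m →
      Axiom L (Eq0 ω (var u) (var m) ∧' Eq0 ω (var v) (var m) ⊃ Eq0 (tp 0) (var u) (var v))
    e-num2 : ∀ u v m →
      Axiom L (Eq0 ω (var u) (var m) ∧' Eq0 (tp 0) (var u) (var v) ⊃ Eq0 ω (var v) (var m))
    e-ap : ∀ f x y g u v →
      Axiom L (Ap (var f) (var x) (var y) ∧' Eq0 (tp 0) (var f) (var g) ∧' Eq0 (tp 0) (var x) (var u)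
               ∧' Eq0 (tp 0) (var y) (var v) ⊃ Ap (var g) (var u) (var v))
    e-mem : ∀ k X Y U Z →
      Axiom L (Mem k (var X) (var Y) ∧' EqT (tp k) (var X) (var U) ∧' EqT (tp (suc k)) (var Y) (var Z)
               ⊃ Mem k (var U) (var Z))
    c-ap : ∀ f x y z →
      Axiom L (Ap (var f) (var x) (var y) ∧' Ap (var f) (var x) (var z) ⊃ Eq0 (tp 0) (var y) (var z))
    c-k  : ∀ x y → Axiom L ((cst kc · v0 x · v0 y) ≃ x)
    c-s↓ : ∀ x y → Axiom L ((cst sc · v0 x · v0 y) ↓)
    c-s  : ∀ x y z → Axiom L ((cst sc · v0 x · v0 y · v0 z) ≅ (v0 x · v0 z · (v0 y · v0 z)))
    c-p↓ : ∀ x y → Axiom L ((cst pc · v0 x · v0 y) ↓)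
    c-p0 : ∀ x y → Axiom L (¬' ((cst pc · v0 x · v0 y) ≃ₑ atm zer))
    c-p1↓ : ∀ x → Axiom L ((cst p1c · v0 x) ↓)
    c-p2↓ : ∀ x → Axiom L ((cst p2c · v0 x) ↓)
    c-p1 : ∀ x₁ x₂ → Axiom L ((cst p1c · (cst pc · v0 x₁ · v0 x₂)) ≃ x₁)
    c-p2 : ∀ x₁ x₂ → Axiom L ((cst p2c · (cst pc · v0 x₁ · v0 x₂)) ≃ x₂)
    c-suc : ∀ n → Axiom L (∃' ω (suc n)
                    ((cst pc · atm (var {ω} n) · atm zer) ≃ₑ atm (var {ω} (suc n))))
    c-pk : ∀ k x Y → Axiom L (∃' (tp k) (suc (x ⊔ Y))
                    ((cst pc · v0 x · atm (var {tp k} Y)) ≃ₑ atm (var {tp k} (suc (x ⊔ Y)))))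
    c-d= : ∀ x y n m → Axiom L (EqT ω (var n) (var m)
                    ⊃ (cst dc · v0 x · v0 y · atm (var {ω} n) · atm (var {ω} m)) ≃ x)
    c-d≠ : ∀ x y n m → Axiom L (¬' (EqT ω (var n) (var m))
                    ⊃ (cst dc · v0 x · v0 y · atm (var {ω} n) · atm (var {ω} m)) ≃ y)
    c-nameN : ∀ n → Axiom L (∃' (tp 0) (suc n) (Eq0 ω (var (suc n)) (var n)))
    c-nameK : ∀ k Y → Axiom L (∃' (tp 0) (suc Y) (Eq0 (tp k) (var (suc Y)) (var Y)))
    comp : ∀ k i (X : List Var) φ →
      All (λ v → T (tyOK (suc k) (proj₁ v))) X →
      T (elementary (suc k) φ) →
      (∀ s j → T (isFree s j φ) → (s , j) ∈ ((tp k , i) ∷ X)) →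
      Axiom L (compAx k i X φ)

  -- derivability in BT_s (L = int) resp. BT_s^cl (L = cl):
  -- every formula in the derivation contains only types ≤ s.
  data Prov (L : Logic) (s : ℕ) : Formula → Set where
    ax  : ∀ {φ} → Axiom L φ → T (typesOK s φ) → Prov L s φ
    mp  : ∀ {φ ψ} → Prov L s φ → Prov L s (φ ⊃ ψ) → Prov L s ψ
    gen∀ : ∀ φ ψ r i → T (not (isFree r i φ)) → T (typesOK s (φ ⊃ ∀' r i ψ)) →
           Prov L s (φ ⊃ ψ) → Prov L s (φ ⊃ ∀' r i ψ)
    gen∃ : ∀ φ ψ r i → T (not (isFree r i ψ)) → T (typesOK s (∃' r i φ ⊃ ψ)) →
           Prov L s (φ ⊃ ψ) → Prov L s (∃' r i φ ⊃ ψ)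
    ind : ∀ φ n m → T (not (isFree ω m φ)) → T (freeFor ω n (var m) φ) →
          Prov L s (subst ω n zer φ) →
          Prov L s (φ ⊃ ∃' ω m (((cst pc · atm (var {ω} n) · atm zer) ≃ₑ atm (var {ω} m))
                                 ∧' subst ω n (var m) φ)) →
          Prov L s φ

  -- Negative translation (fuel-based rendering of the recursion on Gödel numbers)

  mutual
    negC : ℕ → Const → Const
    negC (suc f) (cc n) = negCode f n (decode n)
    negC _ a = a

    negCode : ℕ → ℕ → Maybe Triple → Const
    negCode f n (just (k , i , X , φ)) = cc (code (k , i , X , negF f φ))
    negCode f n nothing = cc n

    negT : ℕ → {s : Ty} → Term s → Term s
    negT f (var i) = var i
    negT f (con a) = con (negC f a)
    negT f zer = zer

    negF : ℕ → Formula → Formula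
    negF f (Ap a b c) = ¬' ¬' Ap (negT f a) (negT f b) (negT f c)
    negF f (Eq0 s a b) = ¬' ¬' Eq0 s (negT f a) (negT f b)
    negF f (Mem k a b) = ¬' ¬' Mem k (negT f a) (negT f b)
    negF f ⊥' = ⊥'
    negF f (φ ∧' ψ) = negF f φ ∧' negF f ψ
    negF f (φ ∨' ψ) = ¬' ¬' (negF f φ ∨' negF f ψ)
    negF f (φ ⊃ ψ) = negF f φ ⊃ negF f ψ
    negF f (∀' s i φ) = ∀' s i (negF f φ)
    negF f (∃' s i φ) = ¬' ¬' ∃' s i (negF f φ)

  -- φ⁻ : fuel exceeds every index of a comprehension constant in φ
  neg : Formula → Formula
  neg φ = negF (suc (foldr _⊔_ 0 (constsF φ))) φ

-- Every φ⁻ is ¬¬-stable, which takes care of the classical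
-- logical axioms (excluded middle becomes ¬¬(φ⁻ ∨ ¬φ⁻)) and of ∃-elimination. The non-logical axioms other
-- than comprehension are built from positive formulas (atoms, ⊥, ∧, ∃), for which φ̃ ⊃ φ⁻ and φ⁻ ⊃ ¬¬φ̃,
-- and contain no comprehension constant, so that φ̃ = φ. The comprehension axiom for φ follows from the
-- one for φ⁻, since c_n⁻ is c_{n⁻}. Only for the induction rule is the translated premise
-- ¬¬∃m(p n 0 ≃ m ∧ φ⁻[m]) too weak; there the successor axiom, uniqueness of successors and
-- Leibniz's law for numerals recover ∃m(p n 0 ≃ m ∧ φ⁻[m]).

module Submission where

open import Defs
open import Data.Bool using (Bool; true; false; _∧_; _∨_; not; if_then_else_; T)
open import Data.Bool.Properties using (T-≡; T-not-≡; ∨-zeroʳ; ∨-conicalˡ; ∨-conicalʳ; ∧-conicalˡ; ∧-conicalʳ)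
open import Data.Empty using (⊥-elim)
open import Data.Fin using (Fin; #_)
import Data.Fin as Fin
open import Data.List using (List; []; _∷_; _++_; foldr)
open import Data.List.Membership.Propositional using (_∈_)
open import Data.List.Properties using (++-conicalˡ; ++-conicalʳ)
open import Data.List.Relation.Unary.All using (All; []; _∷_)
import Data.List.Relation.Unary.All as All
open import Data.List.Relation.Unary.All.Properties using (++⁻ˡ; ++⁻ʳ; ++⁺)
open import Data.Maybe using (just; nothing)
open import Data.Nat using (ℕ; zero; suc; _+_; _⊔_; _<_; _≤_; _≡ᵇ_; z≤n; s≤s)
open import Data.Nat.Properties using (_≟_; <⇒≢; <-trans; <-≤-trans; ≤-<-trans; ≤-reflexive; ≤-trans; +-monoˡ-≤; m≤n+m; m≢1+n+m; m≤m⊔n; m≤n⊔m; m≤n⇒m⊔n≡n; m≤n⇒m≤1+n; m⊔n<o⇒m<o; m⊔n<o⇒n<o; n<1+n; n≤1+n; n≤0⇒n≡0; ⊔-identityʳ)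
open import Data.Product using (_×_; _,_; proj₁; ∃)
open import Data.Unit using (tt)
open import Function using (Equivalence)
open import Relation.Nullary using (yes; no)
open import Relation.Nullary.Decidable using (dec-true; dec-false)
open import Relation.Binary.PropositionalEquality using (_≡_; _≢_; refl; sym; trans; cong; cong₂) renaming (subst to transport)

∨-false : ∀ {x y} → x ≡ false → y ≡ false → x ∨ y ≡ false
∨-false refl refl = refl

∧-true : ∀ {x y} → x ≡ true → y ≡ true → x ∧ y ≡ true
∧-true refl refl = refl

if-false : ∀ c {x} → c ≡ false → x ≡ true → (if c then true else x) ≡ true
if-false false _ x = x

if-true : ∀ c {x} → x ≡ true → (if c then true else x) ≡ true
if-true false x = x
if-true true _ = refl

not-true : ∀ {x} → not x ≡ true → x ≡ false
not-true {false} _ = refl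

cong₃ : ∀ {A B C D : Set} (f : A → B → C → D) {a a′ b b′ c c′} →
        a ≡ a′ → b ≡ b′ → c ≡ c′ → f a b c ≡ f a′ b′ c′
cong₃ f refl refl refl = refl

≡ᵇ-refl : ∀ n → (n ≡ᵇ n) ≡ true
≡ᵇ-refl n = dec-true (n ≟ n) refl

≢⇒≡ᵇ-false : ∀ {m n} → m ≢ n → (m ≡ᵇ n) ≡ false
≢⇒≡ᵇ-false {m} {n} = dec-false (m ≟ n)

sameVar-refl : ∀ a i → sameVar a i a i ≡ true
sameVar-refl a i with a ≟Ty a
... | yes _ = ≡ᵇ-refl i
... | no a≢a = ⊥-elim (a≢a refl)

sameVar-≢ : ∀ a i b j → (a ≡ b → i ≢ j) → sameVar a i b j ≡ false
sameVar-≢ a i b j h with a ≟Ty b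
... | no _ = refl
... | yes a≡b = ≢⇒≡ᵇ-false (h a≡b)

sameVar⇒≡ : ∀ a i b j → sameVar a i b j ≡ true → (a ≡ b) × (i ≡ j)
sameVar⇒≡ a i b j h with a ≟Ty b | i ≟ j
... | yes a≡b | yes i≡j = a≡b , i≡j
... | yes _ | no i≢j = ⊥-elim (false≢true (trans (sym (≢⇒≡ᵇ-false i≢j)) h))
  where false≢true : false ≢ true
        false≢true ()

sameVar-sym : ∀ a i b j → sameVar a i b j ≡ sameVar b j a i
sameVar-sym a i b j with sameVar a i b j in e
... | true with sameVar⇒≡ a i b j e
...   | refl , refl = sym (sameVar-refl a i)
sameVar-sym a i b j | false = sym (sameVar-≢ b j a i (λ { refl refl → swap (sameVar-refl a i) e }))
  where swap : ∀ {x} → x ≡ true → x ≡ false → _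
        swap refl ()

substT-miss : ∀ a i (t : Term a) {b} j → sameVar a i b j ≡ false → substT a i t (var {b} j) ≡ var j
substT-miss a i t {b} j h with a ≟Ty b
... | no _ = refl
... | yes refl with i ≡ᵇ j
...   | false = refl

substT-hit : ∀ a i (t : Term a) → substT a i t (var {a} i) ≡ t
substT-hit a i t with a ≟Ty a
... | no a≢a = ⊥-elim (a≢a refl)
... | yes refl rewrite ≡ᵇ-refl i = refl

substT-notOcc : ∀ a i (t : Term a) {b} (u : Term b) → occT a i u ≡ false → substT a i t u ≡ u
substT-notOcc a i t (var j) h = substT-miss a i t j h
substT-notOcc a i t (con c) h = refl
substT-notOcc a i t zer h = refl

substT-otherType : ∀ a i (t : Term a) {b} (u : Term b) → a ≢ b → substT a i t u ≡ u
substT-otherType a i t {b} (var j) a≢b = substT-miss a i t j (sameVar-≢ a i b j (λ a≡b → ⊥-elim (a≢b a≡b)))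
substT-otherType a i t (con c) _ = refl
substT-otherType a i t zer _ = refl

substT-id : ∀ a i {b} (u : Term b) → substT a i (var i) u ≡ u
substT-id a i {b} (var j) with sameVar a i b j in e
... | false = substT-miss a i (var i) j e
... | true with sameVar⇒≡ a i b j e
...   | refl , refl = substT-hit a i (var i)
substT-id a i (con c) = refl
substT-id a i zer = refl

substT-trans : ∀ a n m (t : Term a) {b} (u : Term b) → occT a m u ≡ false →
               substT a m t (substT a n (var m) u) ≡ substT a n t u
substT-trans a n m t {b} (var j) h with sameVar a n b j in e
... | true with sameVar⇒≡ a n b j e
...   | refl , refl rewrite substT-hit a n (var m) | substT-hit a n t = substT-hit a m t
substT-trans a n m t {b} (var j) h | false
  rewrite substT-miss a n (var m) j e | substT-miss a n t j e = substT-miss a m t j h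
substT-trans a n m t (con c) h = refl
substT-trans a n m t zer h = refl

occT-fresh : ∀ a v {b} (u : Term b) → maxT u < v → occT a v u ≡ false
occT-fresh a v {b} (var j) j<v = sameVar-≢ a v b j (λ _ v≡j → <⇒≢ j<v (sym v≡j))
occT-fresh a v (con c) _ = refl
occT-fresh a v zer _ = refl

subst-notFree : ∀ a i (t : Term a) A → isFree a i A ≡ false → subst a i t A ≡ A
subst-notFree a i t (Ap x y z) h =
  cong₃ Ap (substT-notOcc a i t x (∨-conicalˡ (occT a i x) _ h))
           (substT-notOcc a i t y (∨-conicalˡ (occT a i y) _ yz))
           (substT-notOcc a i t z (∨-conicalʳ (occT a i y) _ yz))
  where yz = ∨-conicalʳ (occT a i x) _ h
subst-notFree a i t (Eq0 r x y) h =
  cong₂ (Eq0 r) (substT-notOcc a i t x (∨-conicalˡ _ _ h)) (substT-notOcc a i t y (∨-conicalʳ _ _ h))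
subst-notFree a i t (Mem k x y) h =
  cong₂ (Mem k) (substT-notOcc a i t x (∨-conicalˡ _ _ h)) (substT-notOcc a i t y (∨-conicalʳ _ _ h))
subst-notFree a i t ⊥' h = refl
subst-notFree a i t (A ∧' B) h =
  cong₂ _∧'_ (subst-notFree a i t A (∨-conicalˡ _ _ h)) (subst-notFree a i t B (∨-conicalʳ _ _ h))
subst-notFree a i t (A ∨' B) h =
  cong₂ _∨'_ (subst-notFree a i t A (∨-conicalˡ _ _ h)) (subst-notFree a i t B (∨-conicalʳ _ _ h))
subst-notFree a i t (A ⊃ B) h =
  cong₂ _⊃_ (subst-notFree a i t A (∨-conicalˡ _ _ h)) (subst-notFree a i t B (∨-conicalʳ _ _ h))
subst-notFree a i t (∀' b j A) h with sameVar b j a i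
... | true = refl
... | false = cong (∀' b j) (subst-notFree a i t A h)
subst-notFree a i t (∃' b j A) h with sameVar b j a i
... | true = refl
... | false = cong (∃' b j) (subst-notFree a i t A h)

subst-id : ∀ a i A → subst a i (var i) A ≡ A
subst-id a i (Ap x y z) = cong₃ Ap (substT-id a i x) (substT-id a i y) (substT-id a i z)
subst-id a i (Eq0 r x y) = cong₂ (Eq0 r) (substT-id a i x) (substT-id a i y)
subst-id a i (Mem k x y) = cong₂ (Mem k) (substT-id a i x) (substT-id a i y)
subst-id a i ⊥' = refl
subst-id a i (A ∧' B) = cong₂ _∧'_ (subst-id a i A) (subst-id a i B)
subst-id a i (A ∨' B) = cong₂ _∨'_ (subst-id a i A) (subst-id a i B)
subst-id a i (A ⊃ B) = cong₂ _⊃_ (subst-id a i A) (subst-id a i B)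
subst-id a i (∀' b j A) with sameVar b j a i
... | true = refl
... | false = cong (∀' b j) (subst-id a i A)
subst-id a i (∃' b j A) with sameVar b j a i
... | true = refl
... | false = cong (∃' b j) (subst-id a i A)

freeFor-binder : ∀ a i (t : Term a) b j A → occT b j t ≡ false → freeFor a i t A ≡ true →
                 ((not (isFree a i A) ∨ not (occT b j t)) ∧ freeFor a i t A) ≡ true
freeFor-binder a i t b j A o f rewrite o = ∧-true (∨-zeroʳ _) f

freeFor-id : ∀ a i A → freeFor a i (var i) A ≡ true
freeFor-id a i (Ap x y z) = refl
freeFor-id a i (Eq0 r x y) = refl
freeFor-id a i (Mem k x y) = refl
freeFor-id a i ⊥' = refl
freeFor-id a i (A ∧' B) = ∧-true (freeFor-id a i A) (freeFor-id a i B)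
freeFor-id a i (A ∨' B) = ∧-true (freeFor-id a i A) (freeFor-id a i B)
freeFor-id a i (A ⊃ B) = ∧-true (freeFor-id a i A) (freeFor-id a i B)
freeFor-id a i (∀' b j A) with sameVar b j a i in e
... | true = refl
... | false = ∧-true (∨-zeroʳ _) (freeFor-id a i A)
freeFor-id a i (∃' b j A) with sameVar b j a i in e
... | true = refl
... | false = ∧-true (∨-zeroʳ _) (freeFor-id a i A)

isFree-fresh : ∀ a v A → maxF A < v → isFree a v A ≡ false
isFree-fresh a v (Ap x y z) lt =
  ∨-false (occT-fresh a v x (m⊔n<o⇒m<o _ _ (m⊔n<o⇒m<o _ _ lt)))
          (∨-false (occT-fresh a v y (m⊔n<o⇒n<o (maxT x) _ (m⊔n<o⇒m<o _ (maxT z) lt)))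
                   (occT-fresh a v z (m⊔n<o⇒n<o _ _ lt)))
isFree-fresh a v (Eq0 r x y) lt =
  ∨-false (occT-fresh a v x (m⊔n<o⇒m<o _ _ lt)) (occT-fresh a v y (m⊔n<o⇒n<o _ _ lt))
isFree-fresh a v (Mem k x y) lt =
  ∨-false (occT-fresh a v x (m⊔n<o⇒m<o _ _ lt)) (occT-fresh a v y (m⊔n<o⇒n<o _ _ lt))
isFree-fresh a v ⊥' lt = refl
isFree-fresh a v (A ∧' B) lt =
  ∨-false (isFree-fresh a v A (m⊔n<o⇒m<o _ _ lt)) (isFree-fresh a v B (m⊔n<o⇒n<o _ _ lt))
isFree-fresh a v (A ∨' B) lt =
  ∨-false (isFree-fresh a v A (m⊔n<o⇒m<o _ _ lt)) (isFree-fresh a v B (m⊔n<o⇒n<o _ _ lt))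
isFree-fresh a v (A ⊃ B) lt =
  ∨-false (isFree-fresh a v A (m⊔n<o⇒m<o _ _ lt)) (isFree-fresh a v B (m⊔n<o⇒n<o _ _ lt))
isFree-fresh a v (∀' b j A) lt with sameVar b j a v
... | true = refl
... | false = isFree-fresh a v A (m⊔n<o⇒n<o j _ lt)
isFree-fresh a v (∃' b j A) lt with sameVar b j a v
... | true = refl
... | false = isFree-fresh a v A (m⊔n<o⇒n<o j _ lt)

freeFor-fresh : ∀ a i v A → maxF A < v → freeFor a i (var {a} v) A ≡ true
freeFor-fresh a i v (Ap x y z) lt = refl
freeFor-fresh a i v (Eq0 r x y) lt = refl
freeFor-fresh a i v (Mem k x y) lt = refl
freeFor-fresh a i v ⊥' lt = refl
freeFor-fresh a i v (A ∧' B) lt =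
  ∧-true (freeFor-fresh a i v A (m⊔n<o⇒m<o _ _ lt)) (freeFor-fresh a i v B (m⊔n<o⇒n<o _ _ lt))
freeFor-fresh a i v (A ∨' B) lt =
  ∧-true (freeFor-fresh a i v A (m⊔n<o⇒m<o _ _ lt)) (freeFor-fresh a i v B (m⊔n<o⇒n<o _ _ lt))
freeFor-fresh a i v (A ⊃ B) lt =
  ∧-true (freeFor-fresh a i v A (m⊔n<o⇒m<o _ _ lt)) (freeFor-fresh a i v B (m⊔n<o⇒n<o _ _ lt))
freeFor-fresh a i v (∀' b j A) lt =
  if-true (sameVar b j a i) (freeFor-binder a i (var v) b j A
    (sameVar-≢ b j a v (λ _ → <⇒≢ (m⊔n<o⇒m<o j _ lt))) (freeFor-fresh a i v A (m⊔n<o⇒n<o j _ lt)))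
freeFor-fresh a i v (∃' b j A) lt =
  if-true (sameVar b j a i) (freeFor-binder a i (var v) b j A
    (sameVar-≢ b j a v (λ _ → <⇒≢ (m⊔n<o⇒m<o j _ lt))) (freeFor-fresh a i v A (m⊔n<o⇒n<o j _ lt)))

notFree-under-binder : ∀ x y → (not x ∨ false) ∧ y ≡ true → x ≡ false
notFree-under-binder false _ _ = refl

subst-trans : ∀ a n m (t : Term a) A → isFree a m A ≡ false → freeFor a n (var m) A ≡ true →
              subst a m t (subst a n (var m) A) ≡ subst a n t A
subst-trans a n m t (Ap x y z) h _ =
  cong₃ Ap (substT-trans a n m t x (∨-conicalˡ (occT a m x) _ h))
           (substT-trans a n m t y (∨-conicalˡ (occT a m y) _ yz))
           (substT-trans a n m t z (∨-conicalʳ (occT a m y) _ yz))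
  where yz = ∨-conicalʳ (occT a m x) _ h
subst-trans a n m t (Eq0 r x y) h _ =
  cong₂ (Eq0 r) (substT-trans a n m t x (∨-conicalˡ _ _ h)) (substT-trans a n m t y (∨-conicalʳ (occT a m x) _ h))
subst-trans a n m t (Mem k x y) h _ =
  cong₂ (Mem k) (substT-trans a n m t x (∨-conicalˡ _ _ h)) (substT-trans a n m t y (∨-conicalʳ (occT a m x) _ h))
subst-trans a n m t ⊥' h _ = refl
subst-trans a n m t (A ∧' B) h f =
  cong₂ _∧'_ (subst-trans a n m t A (∨-conicalˡ _ _ h) (∧-conicalˡ _ _ f))
             (subst-trans a n m t B (∨-conicalʳ (isFree a m A) _ h) (∧-conicalʳ (freeFor a n (var m) A) _ f))
subst-trans a n m t (A ∨' B) h f =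
  cong₂ _∨'_ (subst-trans a n m t A (∨-conicalˡ _ _ h) (∧-conicalˡ _ _ f))
             (subst-trans a n m t B (∨-conicalʳ (isFree a m A) _ h) (∧-conicalʳ (freeFor a n (var m) A) _ f))
subst-trans a n m t (A ⊃ B) h f =
  cong₂ _⊃_ (subst-trans a n m t A (∨-conicalˡ _ _ h) (∧-conicalˡ _ _ f))
            (subst-trans a n m t B (∨-conicalʳ (isFree a m A) _ h) (∧-conicalʳ (freeFor a n (var m) A) _ f))
subst-trans a n m t (∀' b j B) h f with sameVar b j a n | sameVar b j a m in e
... | true | true rewrite e = refl
... | true | false rewrite e = cong (∀' b j) (subst-notFree a m t B h)
... | false | true rewrite e = cong (∀' b j) (trans (subst-notFree a n (var m) B nf) (sym (subst-notFree a n t B nf)))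
  where nf = notFree-under-binder (isFree a n B) _ f
... | false | false rewrite e = cong (∀' b j) (subst-trans a n m t B h (∧-conicalʳ _ _ f))
subst-trans a n m t (∃' b j B) h f with sameVar b j a n | sameVar b j a m in e
... | true | true rewrite e = refl
... | true | false rewrite e = cong (∃' b j) (subst-notFree a m t B h)
... | false | true rewrite e = cong (∃' b j) (trans (subst-notFree a n (var m) B nf) (sym (subst-notFree a n t B nf)))
  where nf = notFree-under-binder (isFree a n B) _ f
... | false | false rewrite e = cong (∃' b j) (subst-trans a n m t B h (∧-conicalʳ _ _ f))

typesOK-subst : ∀ n a i (t : Term a) A → typesOK n (subst a i t A) ≡ typesOK n A
typesOK-subst n a i t (Ap x y z) = refl
typesOK-subst n a i t (Eq0 r x y) = refl
typesOK-subst n a i t (Mem k x y) = refl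
typesOK-subst n a i t ⊥' = refl
typesOK-subst n a i t (A ∧' B) = cong₂ _∧_ (typesOK-subst n a i t A) (typesOK-subst n a i t B)
typesOK-subst n a i t (A ∨' B) = cong₂ _∧_ (typesOK-subst n a i t A) (typesOK-subst n a i t B)
typesOK-subst n a i t (A ⊃ B) = cong₂ _∧_ (typesOK-subst n a i t A) (typesOK-subst n a i t B)
typesOK-subst n a i t (∀' b j A) with sameVar b j a i
... | true = refl
... | false = cong (tyOK n b ∧_) (typesOK-subst n a i t A)
typesOK-subst n a i t (∃' b j A) with sameVar b j a i
... | true = refl
... | false = cong (tyOK n b ∧_) (typesOK-subst n a i t A)

notFree⇒freeFor : ∀ a i (t : Term a) A → isFree a i A ≡ false → freeFor a i t A ≡ true
notFree⇒freeFor a i t (Ap x y z) h = refl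
notFree⇒freeFor a i t (Eq0 r x y) h = refl
notFree⇒freeFor a i t (Mem k x y) h = refl
notFree⇒freeFor a i t ⊥' h = refl
notFree⇒freeFor a i t (A ∧' B) h =
  ∧-true (notFree⇒freeFor a i t A (∨-conicalˡ _ _ h)) (notFree⇒freeFor a i t B (∨-conicalʳ (isFree a i A) _ h))
notFree⇒freeFor a i t (A ∨' B) h =
  ∧-true (notFree⇒freeFor a i t A (∨-conicalˡ _ _ h)) (notFree⇒freeFor a i t B (∨-conicalʳ (isFree a i A) _ h))
notFree⇒freeFor a i t (A ⊃ B) h =
  ∧-true (notFree⇒freeFor a i t A (∨-conicalˡ _ _ h)) (notFree⇒freeFor a i t B (∨-conicalʳ (isFree a i A) _ h))
notFree⇒freeFor a i t (∀' b j A) h with sameVar b j a i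
... | true = refl
... | false rewrite h = notFree⇒freeFor a i t A h
notFree⇒freeFor a i t (∃' b j A) h with sameVar b j a i
... | true = refl
... | false rewrite h = notFree⇒freeFor a i t A h

absentT : Ty → ℕ → {b : Ty} → Term b → Bool
absentT a y {b} (var j) = not (sameVar a y b j)
absentT a y (con _) = true
absentT a y zer = true

absent : Ty → ℕ → Formula → Bool
absent a y (Ap x z w) = absentT a y x ∧ absentT a y z ∧ absentT a y w
absent a y (Eq0 _ x z) = absentT a y x ∧ absentT a y z
absent a y (Mem _ x z) = absentT a y x ∧ absentT a y z
absent a y ⊥' = true
absent a y (A ∧' B) = absent a y A ∧ absent a y B
absent a y (A ∨' B) = absent a y A ∧ absent a y B
absent a y (A ⊃ B) = absent a y A ∧ absent a y B
absent a y (∀' b j A) = not (sameVar a y b j) ∧ absent a y A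
absent a y (∃' b j A) = not (sameVar a y b j) ∧ absent a y A

absentT⇒notOcc : ∀ a y {b} (u : Term b) → absentT a y u ≡ true → occT a y u ≡ false
absentT⇒notOcc a y (var j) h = not-true h
absentT⇒notOcc a y (con c) h = refl
absentT⇒notOcc a y zer h = refl

absent⇒notFree : ∀ a y A → absent a y A ≡ true → isFree a y A ≡ false
absent⇒notFree a y (Ap x z w) h =
  ∨-false (absentT⇒notOcc a y x (∧-conicalˡ _ _ h))
          (∨-false (absentT⇒notOcc a y z (∧-conicalˡ _ _ zw)) (absentT⇒notOcc a y w (∧-conicalʳ (absentT a y z) _ zw)))
  where zw = ∧-conicalʳ (absentT a y x) _ h
absent⇒notFree a y (Eq0 _ x z) h =
  ∨-false (absentT⇒notOcc a y x (∧-conicalˡ _ _ h)) (absentT⇒notOcc a y z (∧-conicalʳ (absentT a y x) _ h))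
absent⇒notFree a y (Mem _ x z) h =
  ∨-false (absentT⇒notOcc a y x (∧-conicalˡ _ _ h)) (absentT⇒notOcc a y z (∧-conicalʳ (absentT a y x) _ h))
absent⇒notFree a y ⊥' h = refl
absent⇒notFree a y (A ∧' B) h =
  ∨-false (absent⇒notFree a y A (∧-conicalˡ _ _ h)) (absent⇒notFree a y B (∧-conicalʳ (absent a y A) _ h))
absent⇒notFree a y (A ∨' B) h =
  ∨-false (absent⇒notFree a y A (∧-conicalˡ _ _ h)) (absent⇒notFree a y B (∧-conicalʳ (absent a y A) _ h))
absent⇒notFree a y (A ⊃ B) h =
  ∨-false (absent⇒notFree a y A (∧-conicalˡ _ _ h)) (absent⇒notFree a y B (∧-conicalʳ (absent a y A) _ h))
absent⇒notFree a y (∀' b j A) h with sameVar b j a y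
... | true = refl
... | false = absent⇒notFree a y A (∧-conicalʳ (not (sameVar a y b j)) _ h)
absent⇒notFree a y (∃' b j A) h with sameVar b j a y
... | true = refl
... | false = absent⇒notFree a y A (∧-conicalʳ (not (sameVar a y b j)) _ h)

absent⇒freeFor : ∀ a x y A → absent a y A ≡ true → freeFor a x (var {a} y) A ≡ true
absent⇒freeFor a x y (Ap _ _ _) h = refl
absent⇒freeFor a x y (Eq0 _ _ _) h = refl
absent⇒freeFor a x y (Mem _ _ _) h = refl
absent⇒freeFor a x y ⊥' h = refl
absent⇒freeFor a x y (A ∧' B) h =
  ∧-true (absent⇒freeFor a x y A (∧-conicalˡ _ _ h)) (absent⇒freeFor a x y B (∧-conicalʳ (absent a y A) _ h))
absent⇒freeFor a x y (A ∨' B) h =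
  ∧-true (absent⇒freeFor a x y A (∧-conicalˡ _ _ h)) (absent⇒freeFor a x y B (∧-conicalʳ (absent a y A) _ h))
absent⇒freeFor a x y (A ⊃ B) h =
  ∧-true (absent⇒freeFor a x y A (∧-conicalˡ _ _ h)) (absent⇒freeFor a x y B (∧-conicalʳ (absent a y A) _ h))
absent⇒freeFor a x y (∀' b j A) h =
  if-true (sameVar b j a x) (freeFor-binder a x (var y) b j A
    (trans (sameVar-sym b j a y) (not-true (∧-conicalˡ _ _ h)))
    (absent⇒freeFor a x y A (∧-conicalʳ (not (sameVar a y b j)) _ h)))
absent⇒freeFor a x y (∃' b j A) h =
  if-true (sameVar b j a x) (freeFor-binder a x (var y) b j A
    (trans (sameVar-sym b j a y) (not-true (∧-conicalˡ _ _ h)))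
    (absent⇒freeFor a x y A (∧-conicalʳ (not (sameVar a y b j)) _ h)))

subst-rename-inverse : ∀ a x y A → absent a y A ≡ true → subst a y (var x) (subst a x (var y) A) ≡ A
subst-rename-inverse a x y A h =
  trans (subst-trans a x y (var x) A (absent⇒notFree a y A h) (absent⇒freeFor a x y A h)) (subst-id a x A)

occT-subst-var : ∀ a m n v {b} (u : Term b) → occT a m u ≡ false → sameVar a m a v ≡ false →
                 occT a m (substT a n (var v) u) ≡ false
occT-subst-var a m n v {b} (var j) o m≢v with sameVar a n b j in e
... | true with sameVar⇒≡ a n b j e
...   | refl , refl rewrite substT-hit a n (var {a} v) = m≢v
occT-subst-var a m n v {b} (var j) o m≢v | false rewrite substT-miss a n (var {a} v) j e = o
occT-subst-var a m n v (con c) o m≢v = refl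
occT-subst-var a m n v zer o m≢v = refl

occT-rename : ∀ a x y {b} (u : Term b) → sameVar a x a y ≡ false → occT a x (substT a x (var y) u) ≡ false
occT-rename a x y {b} (var j) x≢y with sameVar a x b j in e
... | true with sameVar⇒≡ a x b j e
...   | refl , refl rewrite substT-hit a x (var {a} y) = x≢y
occT-rename a x y {b} (var j) x≢y | false rewrite substT-miss a x (var {a} y) j e = e
occT-rename a x y (con c) _ = refl
occT-rename a x y zer _ = refl

isFree-rename : ∀ a x y A → sameVar a x a y ≡ false → isFree a x (subst a x (var {a} y) A) ≡ false
isFree-rename a x y (Ap u v w) h = ∨-false (occT-rename a x y u h) (∨-false (occT-rename a x y v h) (occT-rename a x y w h))
isFree-rename a x y (Eq0 r u v) h = ∨-false (occT-rename a x y u h) (occT-rename a x y v h)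
isFree-rename a x y (Mem k u v) h = ∨-false (occT-rename a x y u h) (occT-rename a x y v h)
isFree-rename a x y ⊥' h = refl
isFree-rename a x y (A ∧' B) h = ∨-false (isFree-rename a x y A h) (isFree-rename a x y B h)
isFree-rename a x y (A ∨' B) h = ∨-false (isFree-rename a x y A h) (isFree-rename a x y B h)
isFree-rename a x y (A ⊃ B) h = ∨-false (isFree-rename a x y A h) (isFree-rename a x y B h)
isFree-rename a x y (∀' b j A) h with sameVar b j a x in e
... | true rewrite e = refl
... | false rewrite e = isFree-rename a x y A h
isFree-rename a x y (∃' b j A) h with sameVar b j a x in e
... | true rewrite e = refl
... | false rewrite e = isFree-rename a x y A h

isFree-subst-var : ∀ a m n v A → isFree a m A ≡ false → sameVar a m a v ≡ false →
                   isFree a m (subst a n (var {a} v) A) ≡ false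
isFree-subst-var a m n v (Ap x y z) h m≢v =
  ∨-false (occT-subst-var a m n v x (∨-conicalˡ (occT a m x) _ h) m≢v)
          (∨-false (occT-subst-var a m n v y (∨-conicalˡ (occT a m y) _ yz) m≢v)
                   (occT-subst-var a m n v z (∨-conicalʳ (occT a m y) _ yz) m≢v))
  where yz = ∨-conicalʳ (occT a m x) _ h
isFree-subst-var a m n v (Eq0 r x y) h m≢v =
  ∨-false (occT-subst-var a m n v x (∨-conicalˡ _ _ h) m≢v) (occT-subst-var a m n v y (∨-conicalʳ (occT a m x) _ h) m≢v)
isFree-subst-var a m n v (Mem k x y) h m≢v =
  ∨-false (occT-subst-var a m n v x (∨-conicalˡ _ _ h) m≢v) (occT-subst-var a m n v y (∨-conicalʳ (occT a m x) _ h) m≢v)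
isFree-subst-var a m n v ⊥' h m≢v = refl
isFree-subst-var a m n v (A ∧' B) h m≢v =
  ∨-false (isFree-subst-var a m n v A (∨-conicalˡ _ _ h) m≢v) (isFree-subst-var a m n v B (∨-conicalʳ (isFree a m A) _ h) m≢v)
isFree-subst-var a m n v (A ∨' B) h m≢v =
  ∨-false (isFree-subst-var a m n v A (∨-conicalˡ _ _ h) m≢v) (isFree-subst-var a m n v B (∨-conicalʳ (isFree a m A) _ h) m≢v)
isFree-subst-var a m n v (A ⊃ B) h m≢v =
  ∨-false (isFree-subst-var a m n v A (∨-conicalˡ _ _ h) m≢v) (isFree-subst-var a m n v B (∨-conicalʳ (isFree a m A) _ h) m≢v)
isFree-subst-var a m n v (∀' b j B) h m≢v with sameVar b j a n
... | true = h
... | false with sameVar b j a m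
...   | true = refl
...   | false = isFree-subst-var a m n v B h m≢v
isFree-subst-var a m n v (∃' b j B) h m≢v with sameVar b j a n
... | true = h
... | false with sameVar b j a m
...   | true = refl
...   | false = isFree-subst-var a m n v B h m≢v

freeFor-rename : ∀ a x y A → absent a y A ≡ true → sameVar a x a y ≡ false →
                 freeFor a y (var {a} x) (subst a x (var y) A) ≡ true
freeFor-rename a x y (Ap _ _ _) h n = refl
freeFor-rename a x y (Eq0 _ _ _) h n = refl
freeFor-rename a x y (Mem _ _ _) h n = refl
freeFor-rename a x y ⊥' h n = refl
freeFor-rename a x y (A ∧' B) h n =
  ∧-true (freeFor-rename a x y A (∧-conicalˡ _ _ h) n) (freeFor-rename a x y B (∧-conicalʳ (absent a y A) _ h) n)
freeFor-rename a x y (A ∨' B) h n =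
  ∧-true (freeFor-rename a x y A (∧-conicalˡ _ _ h) n) (freeFor-rename a x y B (∧-conicalʳ (absent a y A) _ h) n)
freeFor-rename a x y (A ⊃ B) h n =
  ∧-true (freeFor-rename a x y A (∧-conicalˡ _ _ h) n) (freeFor-rename a x y B (∧-conicalʳ (absent a y A) _ h) n)
freeFor-rename a x y (∀' b j A) h n with sameVar b j a x in e
... | true = if-false (sameVar b j a y) b≢y
               (∧-true (cong (λ z → not z ∨ not (occT b j (var {a} x))) y∉A) (notFree⇒freeFor a y (var x) A y∉A))
  where b≢y = trans (sameVar-sym b j a y) (not-true (∧-conicalˡ _ _ h))
        y∉A = absent⇒notFree a y A (∧-conicalʳ (not (sameVar a y b j)) _ h)
... | false = if-false (sameVar b j a y) (trans (sameVar-sym b j a y) (not-true (∧-conicalˡ _ _ h)))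
                (freeFor-binder a y (var x) b j (subst a x (var y) A) e
                  (freeFor-rename a x y A (∧-conicalʳ (not (sameVar a y b j)) _ h) n))
freeFor-rename a x y (∃' b j A) h n with sameVar b j a x in e
... | true = if-false (sameVar b j a y) b≢y
               (∧-true (cong (λ z → not z ∨ not (occT b j (var {a} x))) y∉A) (notFree⇒freeFor a y (var x) A y∉A))
  where b≢y = trans (sameVar-sym b j a y) (not-true (∧-conicalˡ _ _ h))
        y∉A = absent⇒notFree a y A (∧-conicalʳ (not (sameVar a y b j)) _ h)
... | false = if-false (sameVar b j a y) (trans (sameVar-sym b j a y) (not-true (∧-conicalˡ _ _ h)))
                (freeFor-binder a y (var x) b j (subst a x (var y) A) e
                  (freeFor-rename a x y A (∧-conicalʳ (not (sameVar a y b j)) _ h) n))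

freeFor-closed : ∀ a i (t : Term a) A → (∀ b j → occT b j t ≡ false) → freeFor a i t A ≡ true
freeFor-closed a i t (Ap _ _ _) h = refl
freeFor-closed a i t (Eq0 _ _ _) h = refl
freeFor-closed a i t (Mem _ _ _) h = refl
freeFor-closed a i t ⊥' h = refl
freeFor-closed a i t (A ∧' B) h = ∧-true (freeFor-closed a i t A h) (freeFor-closed a i t B h)
freeFor-closed a i t (A ∨' B) h = ∧-true (freeFor-closed a i t A h) (freeFor-closed a i t B h)
freeFor-closed a i t (A ⊃ B) h = ∧-true (freeFor-closed a i t A h) (freeFor-closed a i t B h)
freeFor-closed a i t (∀' b j A) h = if-true (sameVar b j a i) (freeFor-binder a i t b j A (h b j) (freeFor-closed a i t A h))
freeFor-closed a i t (∃' b j A) h = if-true (sameVar b j a i) (freeFor-binder a i t b j A (h b j) (freeFor-closed a i t A h))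

onlyTp0Binders : Formula → Bool
onlyTp0Binders (A ∧' B) = onlyTp0Binders A ∧ onlyTp0Binders B
onlyTp0Binders (A ∨' B) = onlyTp0Binders A ∧ onlyTp0Binders B
onlyTp0Binders (A ⊃ B) = onlyTp0Binders A ∧ onlyTp0Binders B
onlyTp0Binders (∀' (tp zero) _ A) = onlyTp0Binders A
onlyTp0Binders (∃' (tp zero) _ A) = onlyTp0Binders A
onlyTp0Binders (∀' _ _ A) = false
onlyTp0Binders (∃' _ _ A) = false
onlyTp0Binders _ = true

freeFor-tp0Binders : ∀ a i (t : Term a) A → onlyTp0Binders A ≡ true → (∀ j → occT (tp 0) j t ≡ false) →
                freeFor a i t A ≡ true
freeFor-tp0Binders a i t (Ap _ _ _) o h = refl
freeFor-tp0Binders a i t (Eq0 _ _ _) o h = refl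
freeFor-tp0Binders a i t (Mem _ _ _) o h = refl
freeFor-tp0Binders a i t ⊥' o h = refl
freeFor-tp0Binders a i t (A ∧' B) o h =
  ∧-true (freeFor-tp0Binders a i t A (∧-conicalˡ _ _ o) h) (freeFor-tp0Binders a i t B (∧-conicalʳ (onlyTp0Binders A) _ o) h)
freeFor-tp0Binders a i t (A ∨' B) o h =
  ∧-true (freeFor-tp0Binders a i t A (∧-conicalˡ _ _ o) h) (freeFor-tp0Binders a i t B (∧-conicalʳ (onlyTp0Binders A) _ o) h)
freeFor-tp0Binders a i t (A ⊃ B) o h =
  ∧-true (freeFor-tp0Binders a i t A (∧-conicalˡ _ _ o) h) (freeFor-tp0Binders a i t B (∧-conicalʳ (onlyTp0Binders A) _ o) h)
freeFor-tp0Binders a i t (∀' (tp zero) j A) o h =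
  if-true (sameVar (tp 0) j a i) (freeFor-binder a i t (tp 0) j A (h j) (freeFor-tp0Binders a i t A o h))
freeFor-tp0Binders a i t (∃' (tp zero) j A) o h =
  if-true (sameVar (tp 0) j a i) (freeFor-binder a i t (tp 0) j A (h j) (freeFor-tp0Binders a i t A o h))

constsT-subst : ∀ a i (t : Term a) {b} (u : Term b) → constsT t ≡ [] → constsT (substT a i t u) ≡ constsT u
constsT-subst a i t {b} (var j) h with a ≟Ty b
... | no _ = refl
... | yes refl with i ≡ᵇ j
...   | true = h
...   | false = refl
constsT-subst a i t (con c) h = refl
constsT-subst a i t zer h = refl

constsF-subst : ∀ a i (t : Term a) A → constsT t ≡ [] → constsF (subst a i t A) ≡ constsF A
constsF-subst a i t (Ap x y z) h
  rewrite constsT-subst a i t x h | constsT-subst a i t y h | constsT-subst a i t z h = refl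
constsF-subst a i t (Eq0 r x y) h rewrite constsT-subst a i t x h | constsT-subst a i t y h = refl
constsF-subst a i t (Mem k x y) h rewrite constsT-subst a i t x h | constsT-subst a i t y h = refl
constsF-subst a i t ⊥' h = refl
constsF-subst a i t (A ∧' B) h = cong₂ _++_ (constsF-subst a i t A h) (constsF-subst a i t B h)
constsF-subst a i t (A ∨' B) h = cong₂ _++_ (constsF-subst a i t A h) (constsF-subst a i t B h)
constsF-subst a i t (A ⊃ B) h = cong₂ _++_ (constsF-subst a i t A h) (constsF-subst a i t B h)
constsF-subst a i t (∀' b j A) h with sameVar b j a i
... | true = refl
... | false = constsF-subst a i t A h
constsF-subst a i t (∃' b j A) h with sameVar b j a i
... | true = refl
... | false = constsF-subst a i t A h

∧-true-identityʳ² : ∀ x → (x ∧ true) ∧ true ≡ x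
∧-true-identityʳ² false = refl
∧-true-identityʳ² true = refl

⊔-identityʳ² : ∀ x → (x ⊔ 0) ⊔ 0 ≡ x
⊔-identityʳ² x = trans (⊔-identityʳ _) (⊔-identityʳ x)

∨-false-identityʳ² : ∀ x → (x ∨ false) ∨ false ≡ x
∨-false-identityʳ² false = refl
∨-false-identityʳ² true = refl

module Translation (G : GodelNumbering) where
  open GodelNumbering G
  open BT G

  negT-occT : ∀ f a i {b} (u : Term b) → occT a i (negT f u) ≡ occT a i u
  negT-occT f a i (var j) = refl
  negT-occT f a i (con c) = refl
  negT-occT f a i zer = refl

  negT-maxT : ∀ f {b} (u : Term b) → maxT (negT f u) ≡ maxT u
  negT-maxT f (var j) = refl
  negT-maxT f (con c) = refl
  negT-maxT f zer = refl

  negF-isFree : ∀ f a i A → isFree a i (negF f A) ≡ isFree a i A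
  negF-isFree f a i (Ap x y z) rewrite negT-occT f a i x | negT-occT f a i y | negT-occT f a i z = ∨-false-identityʳ² _
  negF-isFree f a i (Eq0 r x y) rewrite negT-occT f a i x | negT-occT f a i y = ∨-false-identityʳ² _
  negF-isFree f a i (Mem k x y) rewrite negT-occT f a i x | negT-occT f a i y = ∨-false-identityʳ² _
  negF-isFree f a i ⊥' = refl
  negF-isFree f a i (A ∧' B) = cong₂ _∨_ (negF-isFree f a i A) (negF-isFree f a i B)
  negF-isFree f a i (A ∨' B) rewrite negF-isFree f a i A | negF-isFree f a i B = ∨-false-identityʳ² _
  negF-isFree f a i (A ⊃ B) = cong₂ _∨_ (negF-isFree f a i A) (negF-isFree f a i B)
  negF-isFree f a i (∀' b j A) = cong (if sameVar b j a i then false else_) (negF-isFree f a i A)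
  negF-isFree f a i (∃' b j A) rewrite negF-isFree f a i A = ∨-false-identityʳ² _

  negF-freeFor : ∀ f a i (t : Term a) A → freeFor a i (negT f t) (negF f A) ≡ freeFor a i t A
  negF-freeFor f a i t (Ap x y z) = refl
  negF-freeFor f a i t (Eq0 r x y) = refl
  negF-freeFor f a i t (Mem k x y) = refl
  negF-freeFor f a i t ⊥' = refl
  negF-freeFor f a i t (A ∧' B) = cong₂ _∧_ (negF-freeFor f a i t A) (negF-freeFor f a i t B)
  negF-freeFor f a i t (A ∨' B) rewrite negF-freeFor f a i t A | negF-freeFor f a i t B = ∧-true-identityʳ² _
  negF-freeFor f a i t (A ⊃ B) = cong₂ _∧_ (negF-freeFor f a i t A) (negF-freeFor f a i t B)
  negF-freeFor f a i t (∀' b j A)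
    rewrite negF-isFree f a i A | negT-occT f b j t | negF-freeFor f a i t A = refl
  negF-freeFor f a i t (∃' b j A)
    rewrite negF-isFree f a i A | negT-occT f b j t | negF-freeFor f a i t A = ∧-true-identityʳ² _

  negF-typesOK : ∀ f n A → typesOK n (negF f A) ≡ typesOK n A
  negF-typesOK f n (Ap x y z) = refl
  negF-typesOK f n (Eq0 r x y) = ∧-true-identityʳ² _
  negF-typesOK f n (Mem k x y) = ∧-true-identityʳ² _
  negF-typesOK f n ⊥' = refl
  negF-typesOK f n (A ∧' B) = cong₂ _∧_ (negF-typesOK f n A) (negF-typesOK f n B)
  negF-typesOK f n (A ∨' B) rewrite negF-typesOK f n A | negF-typesOK f n B = ∧-true-identityʳ² _
  negF-typesOK f n (A ⊃ B) = cong₂ _∧_ (negF-typesOK f n A) (negF-typesOK f n B)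
  negF-typesOK f n (∀' b j A) = cong (tyOK n b ∧_) (negF-typesOK f n A)
  negF-typesOK f n (∃' b j A) rewrite negF-typesOK f n A = ∧-true-identityʳ² _

  negF-elementary : ∀ f n A → elementary n (negF f A) ≡ elementary n A
  negF-elementary f n (Ap x y z) = refl
  negF-elementary f n (Eq0 r x y) = ∧-true-identityʳ² _
  negF-elementary f n (Mem k x y) = ∧-true-identityʳ² _
  negF-elementary f n ⊥' = refl
  negF-elementary f n (A ∧' B) = cong₂ _∧_ (negF-elementary f n A) (negF-elementary f n B)
  negF-elementary f n (A ∨' B) rewrite negF-elementary f n A | negF-elementary f n B = ∧-true-identityʳ² _
  negF-elementary f n (A ⊃ B) = cong₂ _∧_ (negF-elementary f n A) (negF-elementary f n B)
  negF-elementary f n (∀' b j A) = cong (λ x → tyOK n b ∧ not (isTp n b) ∧ x) (negF-elementary f n A)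
  negF-elementary f n (∃' b j A) rewrite negF-elementary f n A = ∧-true-identityʳ² _

  negF-maxF : ∀ f A → maxF (negF f A) ≡ maxF A
  negF-maxF f (Ap x y z) rewrite negT-maxT f x | negT-maxT f y | negT-maxT f z = ⊔-identityʳ² _
  negF-maxF f (Eq0 r x y) rewrite negT-maxT f x | negT-maxT f y = ⊔-identityʳ² _
  negF-maxF f (Mem k x y) rewrite negT-maxT f x | negT-maxT f y = ⊔-identityʳ² _
  negF-maxF f ⊥' = refl
  negF-maxF f (A ∧' B) = cong₂ _⊔_ (negF-maxF f A) (negF-maxF f B)
  negF-maxF f (A ∨' B) rewrite negF-maxF f A | negF-maxF f B = ⊔-identityʳ² _
  negF-maxF f (A ⊃ B) = cong₂ _⊔_ (negF-maxF f A) (negF-maxF f B)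
  negF-maxF f (∀' b j A) = cong (j ⊔_) (negF-maxF f A)
  negF-maxF f (∃' b j A) rewrite negF-maxF f A = ⊔-identityʳ² _

  negT-substT : ∀ f a i (t : Term a) {b} (u : Term b) → negT f (substT a i t u) ≡ substT a i (negT f t) (negT f u)
  negT-substT f a i t {b} (var j) with a ≟Ty b
  ... | no _ = refl
  ... | yes refl with i ≡ᵇ j
  ...   | true = refl
  ...   | false = refl
  negT-substT f a i t (con c) = refl
  negT-substT f a i t zer = refl

  negF-subst : ∀ f a i (t : Term a) A → negF f (subst a i t A) ≡ subst a i (negT f t) (negF f A)
  negF-subst f a i t (Ap x y z)
    rewrite negT-substT f a i t x | negT-substT f a i t y | negT-substT f a i t z = refl
  negF-subst f a i t (Eq0 r x y) rewrite negT-substT f a i t x | negT-substT f a i t y = refl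
  negF-subst f a i t (Mem k x y) rewrite negT-substT f a i t x | negT-substT f a i t y = refl
  negF-subst f a i t ⊥' = refl
  negF-subst f a i t (A ∧' B) = cong₂ _∧'_ (negF-subst f a i t A) (negF-subst f a i t B)
  negF-subst f a i t (A ∨' B) rewrite negF-subst f a i t A | negF-subst f a i t B = refl
  negF-subst f a i t (A ⊃ B) = cong₂ _⊃_ (negF-subst f a i t A) (negF-subst f a i t B)
  negF-subst f a i t (∀' b j A) with sameVar b j a i
  ... | true = refl
  ... | false = cong (∀' b j) (negF-subst f a i t A)
  negF-subst f a i t (∃' b j A) with sameVar b j a i
  ... | true = refl
  ... | false rewrite negF-subst f a i t A = refl

  -- negF recurses on fuel; it is irrelevant once it exceeds the codes of the comprehension constants.
  FuelBound : ℕ → Formula → Set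
  FuelBound f A = All (_< f) (constsF A)

  negC-basic : ∀ f c → constsT (con c) ≡ [] → negC f c ≡ c
  negC-basic zero c _ = refl
  negC-basic (suc f) kc _ = refl
  negC-basic (suc f) sc _ = refl
  negC-basic (suc f) dc _ = refl
  negC-basic (suc f) pc _ = refl
  negC-basic (suc f) p1c _ = refl
  negC-basic (suc f) p2c _ = refl
  negC-basic (suc f) (cc n) ()

  negT-basic : ∀ f {b} (u : Term b) → constsT u ≡ [] → negT f u ≡ u
  negT-basic f (var j) _ = refl
  negT-basic f zer _ = refl
  negT-basic f (con c) e = cong con (negC-basic f c e)

  negT-basic-fuel : ∀ f g c → constsT (con c) ≡ [] → negT f (con c) ≡ negT g (con c)
  negT-basic-fuel f g c e = cong con (trans (negC-basic f c e) (sym (negC-basic g c e)))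

  mutual
    negC-fuel : ∀ f g n → n < f → n < g → negC f (cc n) ≡ negC g (cc n)
    negC-fuel (suc f) (suc g) n (s≤s n≤f) (s≤s n≤g) with decode n in e
    ... | nothing = refl
    ... | just (k , i , X , φ) = cong (λ ψ → cc (code (k , i , X , ψ))) (negF-fuel f g φ (bound n≤f) (bound n≤g))
      where
        bound : ∀ {h} → n ≤ h → FuelBound h φ
        bound n≤h = All.map (λ c<code → <-≤-trans c<code (≤-trans (≤-reflexive (code-decode n _ e)) n≤h))
                            (code-bound k i X φ)

    negT-fuel : ∀ f g {b} (u : Term b) → All (_< f) (constsT u) → All (_< g) (constsT u) → negT f u ≡ negT g u
    negT-fuel f g (var j) _ _ = refl
    negT-fuel f g zer _ _ = refl
    negT-fuel f g (con (cc n)) (p ∷ []) (q ∷ []) = cong con (negC-fuel f g n p q)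
    negT-fuel f g (con kc) _ _ = negT-basic-fuel f g kc refl
    negT-fuel f g (con sc) _ _ = negT-basic-fuel f g sc refl
    negT-fuel f g (con dc) _ _ = negT-basic-fuel f g dc refl
    negT-fuel f g (con pc) _ _ = negT-basic-fuel f g pc refl
    negT-fuel f g (con p1c) _ _ = negT-basic-fuel f g p1c refl
    negT-fuel f g (con p2c) _ _ = negT-basic-fuel f g p2c refl

    negF-fuel : ∀ f g A → FuelBound f A → FuelBound g A → negF f A ≡ negF g A
    negF-fuel f g (Ap x y z) p q =
      cong₃ (λ a b c → ¬' ¬' Ap a b c) (negT-fuel f g x (++⁻ˡ (constsT x) p) (++⁻ˡ (constsT x) q))
        (negT-fuel f g y (++⁻ˡ (constsT y) (++⁻ʳ (constsT x) p)) (++⁻ˡ (constsT y) (++⁻ʳ (constsT x) q)))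
        (negT-fuel f g z (++⁻ʳ (constsT y) (++⁻ʳ (constsT x) p)) (++⁻ʳ (constsT y) (++⁻ʳ (constsT x) q)))
    negF-fuel f g (Eq0 r x y) p q = cong₂ (λ a b → ¬' ¬' Eq0 r a b)
      (negT-fuel f g x (++⁻ˡ (constsT x) p) (++⁻ˡ (constsT x) q)) (negT-fuel f g y (++⁻ʳ (constsT x) p) (++⁻ʳ (constsT x) q))
    negF-fuel f g (Mem k x y) p q = cong₂ (λ a b → ¬' ¬' Mem k a b)
      (negT-fuel f g x (++⁻ˡ (constsT x) p) (++⁻ˡ (constsT x) q)) (negT-fuel f g y (++⁻ʳ (constsT x) p) (++⁻ʳ (constsT x) q))
    negF-fuel f g ⊥' p q = refl
    negF-fuel f g (A ∧' B) p q = cong₂ _∧'_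
      (negF-fuel f g A (++⁻ˡ (constsF A) p) (++⁻ˡ (constsF A) q)) (negF-fuel f g B (++⁻ʳ (constsF A) p) (++⁻ʳ (constsF A) q))
    negF-fuel f g (A ∨' B) p q = cong₂ (λ a b → ¬' ¬' (a ∨' b))
      (negF-fuel f g A (++⁻ˡ (constsF A) p) (++⁻ˡ (constsF A) q)) (negF-fuel f g B (++⁻ʳ (constsF A) p) (++⁻ʳ (constsF A) q))
    negF-fuel f g (A ⊃ B) p q = cong₂ _⊃_
      (negF-fuel f g A (++⁻ˡ (constsF A) p) (++⁻ˡ (constsF A) q)) (negF-fuel f g B (++⁻ʳ (constsF A) p) (++⁻ʳ (constsF A) q))
    negF-fuel f g (∀' b j A) p q = cong (∀' b j) (negF-fuel f g A p q)
    negF-fuel f g (∃' b j A) p q = cong (λ a → ¬' ¬' ∃' b j a) (negF-fuel f g A p q)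

  -- φ̃ of the paper: every constant a replaced by a⁻, no double negations added
  tilde : ℕ → Formula → Formula
  tilde f (Ap x y z) = Ap (negT f x) (negT f y) (negT f z)
  tilde f (Eq0 r x y) = Eq0 r (negT f x) (negT f y)
  tilde f (Mem k x y) = Mem k (negT f x) (negT f y)
  tilde f ⊥' = ⊥'
  tilde f (A ∧' B) = tilde f A ∧' tilde f B
  tilde f (A ∨' B) = tilde f A ∨' tilde f B
  tilde f (A ⊃ B) = tilde f A ⊃ tilde f B
  tilde f (∀' r i A) = ∀' r i (tilde f A)
  tilde f (∃' r i A) = ∃' r i (tilde f A)

  typesOK-tilde : ∀ f n A → typesOK n (tilde f A) ≡ typesOK n A
  typesOK-tilde f n (Ap x y z) = refl
  typesOK-tilde f n (Eq0 r x y) = refl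
  typesOK-tilde f n (Mem k x y) = refl
  typesOK-tilde f n ⊥' = refl
  typesOK-tilde f n (A ∧' B) = cong₂ _∧_ (typesOK-tilde f n A) (typesOK-tilde f n B)
  typesOK-tilde f n (A ∨' B) = cong₂ _∧_ (typesOK-tilde f n A) (typesOK-tilde f n B)
  typesOK-tilde f n (A ⊃ B) = cong₂ _∧_ (typesOK-tilde f n A) (typesOK-tilde f n B)
  typesOK-tilde f n (∀' r i A) = cong (tyOK n r ∧_) (typesOK-tilde f n A)
  typesOK-tilde f n (∃' r i A) = cong (tyOK n r ∧_) (typesOK-tilde f n A)

  tilde-basic : ∀ f A → constsF A ≡ [] → tilde f A ≡ A
  tilde-basic f (Ap x y z) e =
    cong₃ Ap (negT-basic f x (++-conicalˡ (constsT x) _ e))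
             (negT-basic f y (++-conicalˡ (constsT y) _ yz)) (negT-basic f z (++-conicalʳ (constsT y) _ yz))
    where yz = ++-conicalʳ (constsT x) _ e
  tilde-basic f (Eq0 r x y) e =
    cong₂ (Eq0 r) (negT-basic f x (++-conicalˡ (constsT x) _ e)) (negT-basic f y (++-conicalʳ (constsT x) _ e))
  tilde-basic f (Mem k x y) e =
    cong₂ (Mem k) (negT-basic f x (++-conicalˡ (constsT x) _ e)) (negT-basic f y (++-conicalʳ (constsT x) _ e))
  tilde-basic f ⊥' e = refl
  tilde-basic f (A ∧' B) e =
    cong₂ _∧'_ (tilde-basic f A (++-conicalˡ (constsF A) _ e)) (tilde-basic f B (++-conicalʳ (constsF A) _ e))
  tilde-basic f (A ∨' B) e =
    cong₂ _∨'_ (tilde-basic f A (++-conicalˡ (constsF A) _ e)) (tilde-basic f B (++-conicalʳ (constsF A) _ e))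
  tilde-basic f (A ⊃ B) e =
    cong₂ _⊃_ (tilde-basic f A (++-conicalˡ (constsF A) _ e)) (tilde-basic f B (++-conicalʳ (constsF A) _ e))
  tilde-basic f (∀' r i A) e = cong (∀' r i) (tilde-basic f A e)
  tilde-basic f (∃' r i A) e = cong (∃' r i) (tilde-basic f A e)

  tildeE : ℕ → ETerm → ETerm
  tildeE f (atm u) = atm (negT f u)
  tildeE f (t · τ) = tildeE f t · tildeE f τ

  tildeE-maxE : ∀ f t → maxE (tildeE f t) ≡ maxE t
  tildeE-maxE f (atm u) = negT-maxT f u
  tildeE-maxE f (t · τ) = cong₂ _⊔_ (tildeE-maxE f t) (tildeE-maxE f τ)

  tilde-≃ : ∀ f t x → tilde f (t ≃ x) ≡ (tildeE f t ≃ x)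
  tilde-≃ f (atm u) x = refl
  tilde-≃ f (t · τ) x
    rewrite tildeE-maxE f t | tildeE-maxE f τ
          | tilde-≃ f t (suc (maxE t ⊔ maxE τ ⊔ x)) | tilde-≃ f τ (suc (suc (maxE t ⊔ maxE τ ⊔ x))) = refl

  tilde-≃ₑ : ∀ f t τ → tilde f (t ≃ₑ τ) ≡ (tildeE f t ≃ₑ tildeE f τ)
  tilde-≃ₑ f t τ
    rewrite tildeE-maxE f t | tildeE-maxE f τ
          | tilde-≃ f t (suc (maxE t ⊔ maxE τ)) | tilde-≃ f τ (suc (maxE t ⊔ maxE τ)) = refl

  tildeE-applyTuple : ∀ f c xs →
    tildeE (suc f) (applyTuple (cst (cc c)) xs) ≡ applyTuple (cst (negC (suc f) (cc c))) xs
  tildeE-applyTuple f c [] = refl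
  tildeE-applyTuple f c (x ∷ xs) = cong (cst (negC (suc f) (cc c)) ·_) (tupleFrom-fixed (varE x) xs)
    where
      tupleFrom-fixed : ∀ acc xs → tildeE (suc f) (tupleFrom acc xs) ≡ tupleFrom (tildeE (suc f) acc) xs
      tupleFrom-fixed acc [] = refl
      tupleFrom-fixed acc (x ∷ xs) = tupleFrom-fixed (cst pc · acc · varE x) xs

T-∧⁺ : ∀ {a b} → T a → T b → T (a ∧ b)
T-∧⁺ {true} _ y = y

T-∧⁻ˡ : ∀ {a b} → T (a ∧ b) → T a
T-∧⁻ˡ {true} _ = tt

T-∧⁻ʳ : ∀ {a b} → T (a ∧ b) → T b
T-∧⁻ʳ {true} y = y

-- Hypothetical reasoning: a context Γ = A₁ … Aₙ is discharged as the curried implication A₁ ⊃ … ⊃ Aₙ ⊃ B.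
data Ctx : Set where
  ε : Ctx
  _▸_ : Ctx → Formula → Ctx

infixl 5 _▸_
infixr 3 _⇛_
_⇛_ : Ctx → Formula → Formula
ε ⇛ A = A
(Γ ▸ B) ⇛ A = Γ ⇛ (B ⊃ A)

length : Ctx → ℕ
length ε = 0
length (Γ ▸ _) = suc (length Γ)

-- hypotheses are numbered from the most recent one, which is # 0
lookup : ∀ Γ → Fin (length Γ) → Formula
lookup (Γ ▸ A) Fin.zero = A
lookup (Γ ▸ A) (Fin.suc i) = lookup Γ i

module Derivations (G : GodelNumbering) (s : ℕ) where
  open BT G

  infix 1 ⊢_
  ⊢_ : Formula → Set
  ⊢_ = Prov int s

  -- Every formula of a derivation must be a formula of BT_s, so typing evidence is threaded through.
  record Typed (A : Formula) : Set where
    constructor typed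
    field typedT : T (typesOK s A)
  open Typed public

  typed-⊢ : ∀ {L A} → Prov L s A → Typed A
  typed-⊢ (ax _ o) = typed o
  typed-⊢ (mp {φ} _ q) = typed (T-∧⁻ʳ {typesOK s φ} (typedT (typed-⊢ q)))
  typed-⊢ (gen∀ _ _ _ _ _ o _) = typed o
  typed-⊢ (gen∃ _ _ _ _ _ o _) = typed o
  typed-⊢ (ind φ _ _ _ _ _ q) = typed (T-∧⁻ˡ {typesOK s φ} (typedT (typed-⊢ q)))

  ⊃⁺ : ∀ {A B} → Typed A → Typed B → Typed (A ⊃ B)
  ⊃⁺ (typed a) (typed b) = typed (T-∧⁺ a b)
  ∧⁺ : ∀ {A B} → Typed A → Typed B → Typed (A ∧' B)
  ∧⁺ (typed a) (typed b) = typed (T-∧⁺ a b)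
  ∨⁺ : ∀ {A B} → Typed A → Typed B → Typed (A ∨' B)
  ∨⁺ (typed a) (typed b) = typed (T-∧⁺ a b)
  ∀⁺ : ∀ {r i A} → T (tyOK s r) → Typed A → Typed (∀' r i A)
  ∀⁺ t (typed a) = typed (T-∧⁺ t a)
  ∃⁺ : ∀ {r i A} → T (tyOK s r) → Typed A → Typed (∃' r i A)
  ∃⁺ t (typed a) = typed (T-∧⁺ t a)
  ⊥⁺ : Typed ⊥'
  ⊥⁺ = typed tt
  ¬⁺ : ∀ {A} → Typed A → Typed (¬' A)
  ¬⁺ a = ⊃⁺ a ⊥⁺
  ¬¬⁺ : ∀ {A} → Typed A → Typed (¬' ¬' A)
  ¬¬⁺ a = ¬⁺ (¬⁺ a)

  ⊃⁻ˡ : ∀ {A B} → Typed (A ⊃ B) → Typed A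
  ⊃⁻ˡ {A} (typed o) = typed (T-∧⁻ˡ {typesOK s A} o)
  ⊃⁻ʳ : ∀ {A B} → Typed (A ⊃ B) → Typed B
  ⊃⁻ʳ {A} (typed o) = typed (T-∧⁻ʳ {typesOK s A} o)
  ∧⁻ˡ : ∀ {A B} → Typed (A ∧' B) → Typed A
  ∧⁻ˡ {A} (typed o) = typed (T-∧⁻ˡ {typesOK s A} o)
  ∧⁻ʳ : ∀ {A B} → Typed (A ∧' B) → Typed B
  ∧⁻ʳ {A} (typed o) = typed (T-∧⁻ʳ {typesOK s A} o)
  ∨⁻ˡ : ∀ {A B} → Typed (A ∨' B) → Typed A
  ∨⁻ˡ {A} (typed o) = typed (T-∧⁻ˡ {typesOK s A} o)
  ∨⁻ʳ : ∀ {A B} → Typed (A ∨' B) → Typed B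
  ∨⁻ʳ {A} (typed o) = typed (T-∧⁻ʳ {typesOK s A} o)
  ∀⁻ : ∀ {r i A} → Typed (∀' r i A) → Typed A
  ∀⁻ {r} (typed o) = typed (T-∧⁻ʳ {tyOK s r} o)
  ∃⁻ : ∀ {r i A} → Typed (∃' r i A) → Typed A
  ∃⁻ {r} (typed o) = typed (T-∧⁻ʳ {tyOK s r} o)
  ∀⁻-ty : ∀ {r i A} → Typed (∀' r i A) → T (tyOK s r)
  ∀⁻-ty {r} (typed o) = T-∧⁻ˡ {tyOK s r} o
  ∃⁻-ty : ∀ {r i A} → Typed (∃' r i A) → T (tyOK s r)
  ∃⁻-ty {r} (typed o) = T-∧⁻ˡ {tyOK s r} o

  axiom : ∀ {A} → Axiom int A → Typed A → ⊢ A
  axiom a (typed o) = ax a o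

  ⊢K : ∀ {A B} → Typed A → Typed B → ⊢ A ⊃ B ⊃ A
  ⊢K {A} {B} a b = axiom (lk A B) (⊃⁺ a (⊃⁺ b a))

  ⊢S : ∀ {A B C} → Typed A → Typed B → Typed C → ⊢ (A ⊃ B) ⊃ (A ⊃ B ⊃ C) ⊃ A ⊃ C
  ⊢S {A} {B} {C} a b c = axiom (ls A B C) (⊃⁺ (⊃⁺ a b) (⊃⁺ (⊃⁺ a (⊃⁺ b c)) (⊃⁺ a c)))

  ⊢I : ∀ {A} → Typed A → ⊢ A ⊃ A
  ⊢I {A} a = mp (⊢K {A} {A ⊃ A} a (⊃⁺ a a)) (mp (⊢K {A} {A} a a) (⊢S a (⊃⁺ a a) a))

  data TypedCtx : Ctx → Set where
    ε : TypedCtx ε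
    _▸_ : ∀ {Γ B} → TypedCtx Γ → Typed B → TypedCtx (Γ ▸ B)

  typed-cod : ∀ Γ {A} → Typed (Γ ⇛ A) → Typed A
  typed-cod ε o = o
  typed-cod (Γ ▸ B) o = ⊃⁻ʳ {B} (typed-cod Γ o)

  typed-⊢ᶜ : ∀ {Γ A} → ⊢ Γ ⇛ A → Typed A
  typed-⊢ᶜ {Γ} p = typed-cod Γ (typed-⊢ p)

  lift : ∀ {Γ A} → TypedCtx Γ → ⊢ A → ⊢ Γ ⇛ A
  lift ε p = p
  lift (g ▸ b) p = lift g (mp p (⊢K (typed-⊢ p) b))

  app : ∀ {Γ A B} → TypedCtx Γ → ⊢ Γ ⇛ (A ⊃ B) → ⊢ Γ ⇛ A → ⊢ Γ ⇛ B
  app ε f a = mp a f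
  app {Γ ▸ C} {A} (g ▸ c) f a =
    app g (app g (lift g (⊢S c (⊃⁻ʳ {C} (typed-⊢ᶜ {Γ} a)) (⊃⁻ʳ {A} (⊃⁻ʳ {C} (typed-⊢ᶜ {Γ} f))))) a) f

  weaken : ∀ {Γ A B} → TypedCtx Γ → Typed B → ⊢ Γ ⇛ A → ⊢ (Γ ▸ B) ⇛ A
  weaken {Γ} g b p = app g (lift g (⊢K (typed-⊢ᶜ {Γ} p) b)) p

  hyp : ∀ {Γ} → TypedCtx Γ → (i : Fin (length Γ)) → ⊢ Γ ⇛ lookup Γ i
  hyp (g ▸ a) Fin.zero = lift g (⊢I a)
  hyp (g ▸ b) (Fin.suc i) = weaken g b (hyp g i)

  use : ∀ {Γ A B} → TypedCtx Γ → ⊢ A ⊃ B → ⊢ Γ ⇛ A → ⊢ Γ ⇛ B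
  use g f a = app g (lift g f) a

  use₂ : ∀ {Γ A B C} → TypedCtx Γ → ⊢ A ⊃ B ⊃ C → ⊢ Γ ⇛ A → ⊢ Γ ⇛ B → ⊢ Γ ⇛ C
  use₂ g f a b = app g (app g (lift g f) a) b

  ∧-intro : ∀ {Γ A B} → TypedCtx Γ → ⊢ Γ ⇛ A → ⊢ Γ ⇛ B → ⊢ Γ ⇛ A ∧' B
  ∧-intro {Γ} g a b = use₂ g (axiom (land3 _ _) (⊃⁺ oa (⊃⁺ ob (∧⁺ oa ob)))) a b
    where oa = typed-⊢ᶜ {Γ} a ; ob = typed-⊢ᶜ {Γ} b

  ∧-elimˡ : ∀ {Γ A B} → TypedCtx Γ → ⊢ Γ ⇛ A ∧' B → ⊢ Γ ⇛ A
  ∧-elimˡ {Γ} g p = use g (axiom (land1 _ _) (⊃⁺ o (∧⁻ˡ o))) p where o = typed-⊢ᶜ {Γ} p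

  ∧-elimʳ : ∀ {Γ A B} → TypedCtx Γ → ⊢ Γ ⇛ A ∧' B → ⊢ Γ ⇛ B
  ∧-elimʳ {Γ} g p = use g (axiom (land2 _ _) (⊃⁺ o (∧⁻ʳ o))) p where o = typed-⊢ᶜ {Γ} p

  ∨-introˡ : ∀ {Γ A B} → TypedCtx Γ → Typed B → ⊢ Γ ⇛ A → ⊢ Γ ⇛ A ∨' B
  ∨-introˡ {Γ} g b p = use g (axiom (lor1 _ _) (⊃⁺ o (∨⁺ o b))) p where o = typed-⊢ᶜ {Γ} p

  ∨-introʳ : ∀ {Γ A B} → TypedCtx Γ → Typed A → ⊢ Γ ⇛ B → ⊢ Γ ⇛ A ∨' B
  ∨-introʳ {Γ} g a p = use g (axiom (lor2 _ _) (⊃⁺ o (∨⁺ a o))) p where o = typed-⊢ᶜ {Γ} p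

  ∨-elim : ∀ {Γ A B C} → TypedCtx Γ → ⊢ Γ ⇛ A ∨' B → ⊢ Γ ⇛ A ⊃ C → ⊢ Γ ⇛ B ⊃ C → ⊢ Γ ⇛ C
  ∨-elim {Γ} g d f h =
    app g (app g (app g (lift g (axiom (lor3 _ _ _) (⊃⁺ of (⊃⁺ oh (⊃⁺ od (⊃⁻ʳ of)))))) f) h) d
    where of = typed-⊢ᶜ {Γ} f ; oh = typed-⊢ᶜ {Γ} h ; od = typed-⊢ᶜ {Γ} d

  ⊃-trans : ∀ {A B C} → ⊢ A ⊃ B → ⊢ B ⊃ C → ⊢ A ⊃ C
  ⊃-trans f h = use g h (use g f (hyp g (# 0))) where g = ε ▸ ⊃⁻ˡ (typed-⊢ f)

module Intuitionistic (G : GodelNumbering) (s : ℕ) where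
  open BT G
  open Translation G
  open Derivations G s

  record NotFree (r : Ty) (i : ℕ) (A : Formula) : Set where
    constructor notFree
    field notFree⁻ : isFree r i A ≡ false
  open NotFree public

  notFreeT : ∀ {r i A} → NotFree r i A → T (not (isFree r i A))
  notFreeT nf = Equivalence.from T-not-≡ (notFree⁻ nf)

  NotFree-∀ : ∀ r i A → NotFree r i (∀' r i A)
  NotFree-∀ r i A = notFree (cong (if_then false else isFree r i A) (sameVar-refl r i))

  NotFree-∃ : ∀ r i A → NotFree r i (∃' r i A)
  NotFree-∃ r i A = notFree (cong (if_then false else isFree r i A) (sameVar-refl r i))

  NotFree-⊃ : ∀ {r i A B} → NotFree r i A → NotFree r i B → NotFree r i (A ⊃ B)
  NotFree-⊃ a b = notFree (∨-false (notFree⁻ a) (notFree⁻ b))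

  NotFree-∧ : ∀ {r i A B} → NotFree r i A → NotFree r i B → NotFree r i (A ∧' B)
  NotFree-∧ a b = notFree (∨-false (notFree⁻ a) (notFree⁻ b))

  NotFree-¬ : ∀ {r i A} → NotFree r i A → NotFree r i (¬' A)
  NotFree-¬ a = NotFree-⊃ a (notFree refl)

  typed-subst : ∀ {a i A} (t : Term a) → Typed A → Typed (subst a i t A)
  typed-subst {a} {i} {A} t (typed o) = typed (transport T (sym (typesOK-subst s a i t A)) o)

  typed-negF : ∀ {f A} → Typed A → Typed (negF f A)
  typed-negF {f} {A} (typed o) = typed (transport T (sym (negF-typesOK f s A)) o)

  ∀-inst : ∀ {r i A} (t : Term r) → T (freeFor r i t A) → Typed (∀' r i A) → ⊢ ∀' r i A ⊃ subst r i t A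
  ∀-inst {r} {i} {A} t ff o = axiom (lall r i A t ff) (⊃⁺ o (typed-subst t (∀⁻ o)))

  ∃-intro : ∀ {r i A} (t : Term r) → T (freeFor r i t A) → Typed (∃' r i A) → ⊢ subst r i t A ⊃ ∃' r i A
  ∃-intro {r} {i} {A} t ff o = axiom (lex r i A t ff) (⊃⁺ (typed-subst t (∃⁻ o)) o)

  ∀-elim : ∀ {r i A} → Typed (∀' r i A) → ⊢ ∀' r i A ⊃ A
  ∀-elim {r} {i} {A} o =
    transport (λ X → ⊢ ∀' r i A ⊃ X) (subst-id r i A) (∀-inst (var i) (Equivalence.from T-≡ (freeFor-id r i A)) o)

  ∃-intro-var : ∀ {r i A} → Typed (∃' r i A) → ⊢ A ⊃ ∃' r i A
  ∃-intro-var {r} {i} {A} o =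
    transport (λ X → ⊢ X ⊃ ∃' r i A) (subst-id r i A) (∃-intro (var i) (Equivalence.from T-≡ (freeFor-id r i A)) o)

  ∀-gen : ∀ {B r i A} → NotFree r i B → T (tyOK s r) → ⊢ B ⊃ A → ⊢ B ⊃ ∀' r i A
  ∀-gen {B} {r} {i} {A} nf t p =
    gen∀ B A r i (notFreeT nf) (typedT (⊃⁺ (⊃⁻ˡ (typed-⊢ p)) (∀⁺ {r} {i} t (⊃⁻ʳ (typed-⊢ p))))) p

  ∃-elim : ∀ {C r i A} → NotFree r i C → T (tyOK s r) → ⊢ A ⊃ C → ⊢ ∃' r i A ⊃ C
  ∃-elim {C} {r} {i} {A} nf t p =
    gen∃ A C r i (notFreeT nf) (typedT (⊃⁺ (∃⁺ {r} {i} t (⊃⁻ˡ (typed-⊢ p))) (⊃⁻ʳ (typed-⊢ p)))) p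

  ∀-mono : ∀ {r i A B} → T (tyOK s r) → ⊢ A ⊃ B → ⊢ ∀' r i A ⊃ ∀' r i B
  ∀-mono {r} {i} {A} t p = ∀-gen (NotFree-∀ r i A) t (⊃-trans (∀-elim (∀⁺ t (⊃⁻ˡ (typed-⊢ p)))) p)

  ∃-mono : ∀ {r i A B} → T (tyOK s r) → ⊢ A ⊃ B → ⊢ ∃' r i A ⊃ ∃' r i B
  ∃-mono {r} {i} {A} {B} t p = ∃-elim (NotFree-∃ r i B) t (⊃-trans p (∃-intro-var (∃⁺ t (⊃⁻ʳ (typed-⊢ p)))))

  instantiate : ∀ {a x A} → T (tyOK s a) → ⊢ A → (t : Term a) → T (freeFor a x t A) → ⊢ subst a x t A
  instantiate {a} {x} {A} ta p t ff =
    mp ⊤-proof (⊃-trans (∀-gen {⊤'} {a} {x} (notFree refl) ta (mp p (⊢K (typed-⊢ p) (⊃⁺ ⊥⁺ ⊥⁺))))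
                        (∀-inst t ff (∀⁺ ta (typed-⊢ p))))
    where ⊤' = ⊥' ⊃ ⊥'
          ⊤-proof = ⊢I ⊥⁺

  ∧-map : ∀ {A B C D} → ⊢ A ⊃ C → ⊢ B ⊃ D → ⊢ A ∧' B ⊃ C ∧' D
  ∧-map f h = ∧-intro g (use g f (∧-elimˡ g (hyp g (# 0)))) (use g h (∧-elimʳ g (hyp g (# 0))))
    where g = ε ▸ ∧⁺ (⊃⁻ˡ (typed-⊢ f)) (⊃⁻ˡ (typed-⊢ h))

  ∧-curry⁻ : ∀ {A B C} → ⊢ A ⊃ B ⊃ C → ⊢ A ∧' B ⊃ C
  ∧-curry⁻ p = use₂ g p (∧-elimˡ g (hyp g (# 0))) (∧-elimʳ g (hyp g (# 0)))
    where g = ε ▸ ∧⁺ (⊃⁻ˡ (typed-⊢ p)) (⊃⁻ˡ (⊃⁻ʳ (typed-⊢ p)))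

  ¬¬-intro : ∀ {A} → Typed A → ⊢ A ⊃ ¬' ¬' A
  ¬¬-intro a = app g (hyp g (# 0)) (hyp g (# 1)) where g = ε ▸ a ▸ ¬⁺ a

  ¬¬-mono : ∀ {A B} → ⊢ A ⊃ B → ⊢ ¬' ¬' A ⊃ ¬' ¬' B
  ¬¬-mono f = app g (hyp g (# 1)) (app g′ (hyp g′ (# 1)) (use g′ f (hyp g′ (# 0))))
    where a = ⊃⁻ˡ (typed-⊢ f) ; b = ⊃⁻ʳ (typed-⊢ f)
          g = ε ▸ ¬¬⁺ a ▸ ¬⁺ b
          g′ = g ▸ a

  ¬¬¬-elim : ∀ {A} → Typed A → ⊢ ¬' ¬' ¬' A ⊃ ¬' A
  ¬¬¬-elim a = app g (hyp g (# 1)) (use g (¬¬-intro a) (hyp g (# 0)))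
    where g = ε ▸ ¬⁺ (¬¬⁺ a) ▸ a

  ¬¬-idem : ∀ {A} → Typed A → ⊢ ¬' ¬' ¬' ¬' A ⊃ ¬' ¬' A
  ¬¬-idem a = ¬¬¬-elim (¬⁺ a)

  ¬¬-∧ : ∀ {A B} → Typed A → Typed B → ⊢ ¬' ¬' A ⊃ ¬' ¬' B ⊃ ¬' ¬' (A ∧' B)
  ¬¬-∧ a b =
    app g (hyp g (# 2))
      (app g′ (hyp g′ (# 2))
        (app g″ (hyp g″ (# 2)) (∧-intro g″ (hyp g″ (# 1)) (hyp g″ (# 0)))))
    where g = ε ▸ ¬¬⁺ a ▸ ¬¬⁺ b ▸ ¬⁺ (∧⁺ a b)
          g′ = g ▸ a
          g″ = g′ ▸ b

  ¬¬-⊃ : ∀ {A B} → Typed A → Typed B → ⊢ ¬' ¬' (A ⊃ B) ⊃ ¬' ¬' A ⊃ ¬' ¬' B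
  ¬¬-⊃ a b =
    app g (hyp g (# 2))
      (app g′ (hyp g′ (# 2))
        (app g″ (hyp g″ (# 2)) (app g″ (hyp g″ (# 1)) (hyp g″ (# 0)))))
    where g = ε ▸ ¬¬⁺ (⊃⁺ a b) ▸ ¬¬⁺ a ▸ ¬⁺ b
          g′ = g ▸ ⊃⁺ a b
          g″ = g′ ▸ a

  negF-stable : ∀ f A → Typed A → ⊢ ¬' ¬' negF f A ⊃ negF f A
  negF-stable f (Ap x y z) o = ¬¬-idem (typed tt)
  negF-stable f (Eq0 r x y) (typed o) = ¬¬-idem (typed o)
  negF-stable f (Mem k x y) (typed o) = ¬¬-idem (typed o)
  negF-stable f ⊥' o = app g (hyp g (# 0)) (lift g (⊢I ⊥⁺)) where g = ε ▸ ¬¬⁺ ⊥⁺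
  negF-stable f (A ∧' B) o =
    ∧-intro g (use g (negF-stable f A (∧⁻ˡ o)) (use g (¬¬-mono (axiom (land1 _ _) (⊃⁺ ab a))) (hyp g (# 0))))
              (use g (negF-stable f B (∧⁻ʳ o)) (use g (¬¬-mono (axiom (land2 _ _) (⊃⁺ ab b))) (hyp g (# 0))))
    where a = typed-negF {f} {A} (∧⁻ˡ o) ; b = typed-negF {f} {B} (∧⁻ʳ o) ; ab = ∧⁺ a b
          g = ε ▸ ¬¬⁺ ab
  negF-stable f (A ∨' B) o = ¬¬-idem (∨⁺ (typed-negF {f} {A} (∨⁻ˡ o)) (typed-negF {f} {B} (∨⁻ʳ o)))
  negF-stable f (A ⊃ B) o =
    use g (negF-stable f B (⊃⁻ʳ o)) (use₂ g (¬¬-⊃ a b) (hyp g (# 1)) (use g (¬¬-intro a) (hyp g (# 0))))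
    where a = typed-negF {f} {A} (⊃⁻ˡ o) ; b = typed-negF {f} {B} (⊃⁻ʳ o)
          g = ε ▸ ¬¬⁺ (⊃⁺ a b) ▸ a
  negF-stable f (∀' r i A) o =
    ∀-gen (NotFree-¬ (NotFree-¬ (NotFree-∀ r i (negF f A)))) (∀⁻-ty o)
      (⊃-trans (¬¬-mono (∀-elim (∀⁺ {r} {i} (∀⁻-ty o) (typed-negF {f} {A} (∀⁻ o))))) (negF-stable f A (∀⁻ o)))
  negF-stable f (∃' r i A) o = ¬¬-idem (∃⁺ {r} {i} (∃⁻-ty o) (typed-negF {f} {A} (∃⁻ o)))

  ∃-rename : ∀ {a x y A} → absent a y A ≡ true → sameVar a x a y ≡ false → Typed (∃' a x A) →
             ⊢ ∃' a x A ⊃ ∃' a y (subst a x (var y) A)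
  ∃-rename {a} {x} {y} {A} y-absent x≢y o =
    ∃-elim x-notFree (∃⁻-ty o)
      (transport (λ Z → ⊢ Z ⊃ ∃' a y A′) (subst-rename-inverse a x y A y-absent)
        (∃-intro {a} {y} {A′} (var x) (Equivalence.from T-≡ (freeFor-rename a x y A y-absent x≢y))
                 (∃⁺ (∃⁻-ty o) (typed-subst (var y) (∃⁻ o)))))
    where
      A′ = subst a x (var y) A
      x-notFree : NotFree a x (∃' a y A′)
      x-notFree = notFree (trans (cong (if_then false else isFree a x A′) (trans (sameVar-sym a y a x) x≢y))
                                 (isFree-rename a x y A x≢y))

  ∃-elim-rename : ∀ {a x y A C} B → subst a x (var y) A ≡ B → absent a y A ≡ true → sameVar a x a y ≡ false →
                  NotFree a y C → Typed (∃' a x A) → ⊢ B ⊃ C → ⊢ ∃' a x A ⊃ C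
  ∃-elim-rename {a} {x} {y} {A} {C} B eq y-absent x≢y nf o p =
    ⊃-trans (∃-rename y-absent x≢y o) (∃-elim nf (∃⁻-ty o) (transport (λ Z → ⊢ Z ⊃ C) (sym eq) p))

  ⊃-swap : ∀ {A B C} → Typed A → Typed B → Typed C → ⊢ (A ⊃ B ⊃ C) ⊃ B ⊃ A ⊃ C
  ⊃-swap a b c = app g (app g (hyp g (# 2)) (hyp g (# 0))) (hyp g (# 1))
    where g = ε ▸ ⊃⁺ a (⊃⁺ b c) ▸ b ▸ a

  ⊃-exchange : ∀ {Γ A C} → TypedCtx Γ → ⊢ A ⊃ (Γ ⇛ C) → ⊢ Γ ⇛ (A ⊃ C)
  ⊃-exchange ε p = p
  ⊃-exchange {Γ ▸ H} (g ▸ h) p =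
    use g (⊃-swap (⊃⁻ˡ (typed-⊢ p)) h (⊃⁻ʳ (typed-cod Γ (⊃⁻ʳ (typed-⊢ p))))) (⊃-exchange g p)

data Positive : Formula → Set where
  ap  : ∀ x y z → Positive (Ap x y z)
  eq  : ∀ r x y → Positive (Eq0 r x y)
  mem : ∀ k x y → Positive (Mem k x y)
  bot : Positive ⊥'
  _∧ᵖ_ : ∀ {A B} → Positive A → Positive B → Positive (A ∧' B)
  ∃ᵖ : ∀ {r i A} → Positive A → Positive (∃' r i A)

-- Every non-logical axiom other than comprehension has one of these shapes.
data AxiomShape : Formula → Set where
  pos : ∀ {A} → Positive A → AxiomShape A
  imp : ∀ {A B} → Positive A → Positive B → AxiomShape (A ⊃ B)
  neg-imp : ∀ {A B} → Positive A → Positive B → AxiomShape (¬' A ⊃ B)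
  ∀ₛ : ∀ {r i A} → AxiomShape A → AxiomShape (∀' r i A)
  _∧ₛ_ : ∀ {A B} → AxiomShape A → AxiomShape B → AxiomShape (A ∧' B)

positive-≃ : ∀ t x → Positive (t ≃ x)
positive-≃ (atm u) x = eq _ _ _
positive-≃ (t₁ · t₂) x = ∃ᵖ (∃ᵖ (positive-≃ t₁ _ ∧ᵖ (positive-≃ t₂ _ ∧ᵖ ap _ _ _)))

positive-≃ₑ : ∀ t τ → Positive (t ≃ₑ τ)
positive-≃ₑ t τ = ∃ᵖ (positive-≃ t _ ∧ᵖ positive-≃ τ _)

positive-↓ : ∀ t → Positive (t ↓)
positive-↓ t = ∃ᵖ (positive-≃ t _)

positive-EqT : ∀ r A B → Positive (EqT r A B)
positive-EqT r A B = ∃ᵖ (eq _ _ _ ∧ᵖ eq _ _ _)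

module PositiveTranslation (G : GodelNumbering) (s : ℕ) where
  open BT G
  open Translation G
  open Derivations G s
  open Intuitionistic G s

  typed-tilde : ∀ {f A} → Typed A → Typed (tilde f A)
  typed-tilde {f} {A} (typed o) = typed (transport T (sym (typesOK-tilde f s A)) o)

  tilde⇒negF : ∀ f {A} → Typed A → Positive A → ⊢ tilde f A ⊃ negF f A
  tilde⇒negF f o (ap x y z) = ¬¬-intro (typed tt)
  tilde⇒negF f (typed o) (eq r x y) = ¬¬-intro (typed o)
  tilde⇒negF f (typed o) (mem k x y) = ¬¬-intro (typed o)
  tilde⇒negF f o bot = ⊢I ⊥⁺
  tilde⇒negF f {A ∧' B} o (pa ∧ᵖ pb) =
    ∧-map (tilde⇒negF f (∧⁻ˡ o) pa) (tilde⇒negF f (∧⁻ʳ o) pb)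
  tilde⇒negF f {∃' r i A} o (∃ᵖ pa) =
    ⊃-trans (∃-mono (∃⁻-ty o) (tilde⇒negF f (∃⁻ o) pa))
            (¬¬-intro (∃⁺ {r} {i} (∃⁻-ty o) (typed-negF {f} {A} (∃⁻ o))))

  negF⇒¬¬tilde : ∀ f {A} → Typed A → Positive A → ⊢ negF f A ⊃ ¬' ¬' tilde f A
  negF⇒¬¬tilde f o (ap x y z) = ⊢I (¬¬⁺ (typed tt))
  negF⇒¬¬tilde f (typed o) (eq r x y) = ⊢I (¬¬⁺ (typed o))
  negF⇒¬¬tilde f (typed o) (mem k x y) = ⊢I (¬¬⁺ (typed o))
  negF⇒¬¬tilde f o bot = ¬¬-intro ⊥⁺
  negF⇒¬¬tilde f {A ∧' B} o (pa ∧ᵖ pb) =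
    use₂ g (¬¬-∧ (typed-tilde {f} {A} (∧⁻ˡ o)) (typed-tilde {f} {B} (∧⁻ʳ o)))
      (use g (negF⇒¬¬tilde f (∧⁻ˡ o) pa) (∧-elimˡ g (hyp g (# 0))))
      (use g (negF⇒¬¬tilde f (∧⁻ʳ o) pb) (∧-elimʳ g (hyp g (# 0))))
    where g = ε ▸ typed-negF {f} {A ∧' B} o
  negF⇒¬¬tilde f {∃' r i A} o (∃ᵖ pa) = ⊃-trans (¬¬-mono open∃) (¬¬-idem ∃Ã)
    where
      ∃Ã = typed-tilde {f} {∃' r i A} o
      open∃ : ⊢ ∃' r i (negF f A) ⊃ ¬' ¬' ∃' r i (tilde f A)
      open∃ = ∃-elim (NotFree-¬ (NotFree-¬ (NotFree-∃ r i (tilde f A)))) (∃⁻-ty o)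
                (⊃-trans (negF⇒¬¬tilde f (∃⁻ o) pa) (¬¬-mono (∃-intro-var ∃Ã)))

  shape⇒negF : ∀ f {A} → Typed A → AxiomShape A → constsF A ≡ [] → ⊢ A ⊃ negF f A
  shape⇒negF f {A} o (pos p) e = transport (λ X → ⊢ X ⊃ negF f A) (tilde-basic f A e) (tilde⇒negF f o p)
  shape⇒negF f {A ⊃ B} o (imp pa pb) e =
    use g (negF-stable f B ob)
      (use g (¬¬-mono (transport (λ X → ⊢ X ⊃ negF f B) (tilde-basic f B (++-conicalʳ (constsF A) _ e)) (tilde⇒negF f ob pb)))
        (use₂ g (¬¬-⊃ oa ob) (use g (¬¬-intro o) (hyp g (# 1)))
          (transport (λ X → ⊢ (ε ▸ (A ⊃ B) ▸ negF f A) ⇛ ¬' ¬' X) (tilde-basic f A (++-conicalˡ (constsF A) _ e))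
            (use g (negF⇒¬¬tilde f oa pa) (hyp g (# 0))))))
    where oa = ⊃⁻ˡ o ; ob = ⊃⁻ʳ o
          g = ε ▸ o ▸ typed-negF {f} {A} oa
  shape⇒negF f {(A ⊃ ⊥') ⊃ B} o (neg-imp pa pb) e =
    use g (transport (λ X → ⊢ X ⊃ negF f B) (tilde-basic f B (++-conicalʳ (constsF A ++ []) _ e)) (tilde⇒negF f ob pb))
      (app g (hyp g (# 1))
        (app g′ (hyp g′ (# 1))
          (use g′ (transport (λ X → ⊢ X ⊃ negF f A) (tilde-basic f A A-basic) (tilde⇒negF f oa pa)) (hyp g′ (# 0)))))
    where oa = ⊃⁻ˡ (⊃⁻ˡ o) ; ob = ⊃⁻ʳ o
          A-basic = ++-conicalˡ (constsF A) _ (++-conicalˡ (constsF A ++ []) _ e)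
          g = ε ▸ o ▸ ¬⁺ (typed-negF {f} {A} oa)
          g′ = g ▸ oa
  shape⇒negF f {∀' r i A} o (∀ₛ sa) e = ∀-mono (∀⁻-ty o) (shape⇒negF f (∀⁻ o) sa e)
  shape⇒negF f {A ∧' B} o (sa ∧ₛ sb) e =
    ∧-map (shape⇒negF f (∧⁻ˡ o) sa (++-conicalˡ (constsF A) _ e)) (shape⇒negF f (∧⁻ʳ o) sb (++-conicalʳ (constsF A) _ e))

module AxiomTranslation (G : GodelNumbering) (s : ℕ) where
  open GodelNumbering G
  open BT G
  open Translation G
  open Derivations G s
  open Intuitionistic G s
  open PositiveTranslation G s

  stable-⊃ˡ : ∀ {M ψ} → Typed M → Typed ψ → ⊢ ¬' ¬' ψ ⊃ ψ → ⊢ (M ⊃ ψ) ⊃ ¬' ¬' M ⊃ ψ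
  stable-⊃ˡ m p st = use g st (use₂ g (¬¬-⊃ m p) (use g (¬¬-intro (⊃⁺ m p)) (hyp g (# 1))) (hyp g (# 0)))
    where g = ε ▸ ⊃⁺ m p ▸ ¬¬⁺ m

  ⊃-¬¬ʳ : ∀ {M ψ} → Typed M → Typed ψ → ⊢ (ψ ⊃ M) ⊃ ψ ⊃ ¬' ¬' M
  ⊃-¬¬ʳ m p = use g (¬¬-intro m) (app g (hyp g (# 1)) (hyp g (# 0)))
    where g = ε ▸ ⊃⁺ p m ▸ p

  ∨-elim-¬¬ : ∀ {A B C} → Typed A → Typed B → Typed C → ⊢ ¬' ¬' C ⊃ C →
              ⊢ (A ⊃ C) ⊃ (B ⊃ C) ⊃ ¬' ¬' (A ∨' B) ⊃ C
  ∨-elim-¬¬ {A} {B} {C} a b c st =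
    use g st (use₂ g (¬¬-⊃ (∨⁺ a b) c) (use g (¬¬-intro (⊃⁺ (∨⁺ a b) c)) cases) (hyp g (# 0)))
    where g = ε ▸ ⊃⁺ a c ▸ ⊃⁺ b c ▸ ¬¬⁺ (∨⁺ a b)
          g′ = g ▸ ∨⁺ a b
          cases : ⊢ (ε ▸ (A ⊃ C) ▸ (B ⊃ C) ▸ ¬' ¬' (A ∨' B)) ⇛ (A ∨' B) ⊃ C
          cases = ∨-elim g′ (hyp g′ (# 0)) (hyp g′ (# 3)) (hyp g′ (# 2))

  ¬¬-excluded-middle : ∀ {A} → Typed A → ⊢ ¬' ¬' (A ∨' ¬' A)
  ¬¬-excluded-middle a = app g (hyp g (# 0)) (∨-introʳ g a (app g′ (hyp g′ (# 1)) (∨-introˡ g′ (¬⁺ a) (hyp g′ (# 0)))))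
    where g = ε ▸ ¬⁺ (∨⁺ a (¬⁺ a))
          g′ = g ▸ a

  -- The fuel spent on φ inside n⁻ is irrelevant because the constants of φ have codes below n.
  negC-comprehension : ∀ f k i X φ → code (k , i , X , φ) < suc f →
    negC (suc f) (cc (code (k , i , X , φ))) ≡ cc (code (k , i , X , negF (suc f) φ))
  negC-comprehension f k i X φ (s≤s c≤f)
    rewrite decode-code (k , i , X , φ) =
      cong (λ ψ → cc (code (k , i , X , ψ))) (negF-fuel f (suc f) φ below-f (All.map m≤n⇒m≤1+n below-f))
    where below-f = All.map (λ c<code → <-≤-trans c<code c≤f) (code-bound k i X φ)

  comprehension-translation : ∀ f k i X φ → All (λ v → T (tyOK (suc k) (proj₁ v))) X → T (elementary (suc k) φ) →
    (∀ r j → T (isFree r j φ) → (r , j) ∈ ((tp k , i) ∷ X)) →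
    code (k , i , X , φ) < suc f → Typed (compAx k i X φ) → ⊢ negF (suc f) (compAx k i X φ)
  comprehension-translation f k i X φ X-typed φ-elem φ-free c<f o =
    mp instance⁻ (⊃-trans weaken-body (¬¬-intro (⊃⁻ʳ (typed-⊢ weaken-body))))
    where
      F = suc f
      ψ = negF F φ
      u = suc (maxF φ ⊔ maxVars X ⊔ i)
      M = Mem k (var i) (var {tp (suc k)} u)
      A  = applyTuple (cst (cc (code (k , i , X , φ)))) X ≃ₑ atm (var {tp (suc k)} u)
      A⁻ = applyTuple (cst (cc (code (k , i , X , ψ)))) X ≃ₑ atm (var {tp (suc k)} u)
      Body : ℕ → Formula
      Body w = (applyTuple (cst (cc (code (k , i , X , ψ)))) X ≃ₑ atm (var {tp (suc k)} w))
               ∧' ∀' (tp k) i ((Mem k (var i) (var w) ⊃ ψ) ∧' (ψ ⊃ Mem k (var i) (var w)))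
      tilde-A : tilde F A ≡ A⁻
      tilde-A = trans (tilde-≃ₑ F _ _) (cong (λ t → t ≃ₑ atm (var {tp (suc k)} u))
                  (trans (tildeE-applyTuple f _ X) (cong (λ c → applyTuple (cst c) X) (negC-comprehension f k i X φ c<f))))
      same-u : suc (maxF ψ ⊔ maxVars X ⊔ i) ≡ u
      same-u = cong (λ z → suc (z ⊔ maxVars X ⊔ i)) (negF-maxF F φ)
      oA = ∧⁻ˡ (∃⁻ o)
      o∀ = ∧⁻ʳ (∃⁻ o)
      oM = ⊃⁻ˡ (∧⁻ˡ (∀⁻ o∀))
      oφ = ⊃⁻ʳ (∧⁻ˡ (∀⁻ o∀))
      oψ = typed-negF {F} {φ} oφ
      ∃-body : Typed (∃' (tp (suc k)) u (Body u))
      ∃-body = ∃⁺ (∃⁻-ty o) (∧⁺ (transport Typed tilde-A (typed-tilde {F} {A} oA))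
                                (∀⁺ (∀⁻-ty o∀) (∧⁺ (⊃⁺ oM oψ) (⊃⁺ oψ oM))))
      instance⁻ : ⊢ ∃' (tp (suc k)) u (Body u)
      instance⁻ = transport (λ w → ⊢ ∃' (tp (suc k)) w (Body w)) same-u
        (axiom (comp k i X ψ X-typed (transport T (sym (negF-elementary F (suc k) φ)) φ-elem)
                     (λ r j h → φ-free r j (transport T (negF-isFree F r j φ) h)))
               (transport (λ w → Typed (∃' (tp (suc k)) w (Body w))) (sym same-u) ∃-body))
      weaken-body : ⊢ ∃' (tp (suc k)) u (Body u) ⊃ ∃' (tp (suc k)) u (negF F (A ∧' ∀' (tp k) i (M ⇔ φ)))
      weaken-body = ∃-mono (∃⁻-ty o)
        (∧-map (transport (λ Z → ⊢ Z ⊃ negF F A) tilde-A (tilde⇒negF F oA (positive-≃ₑ _ _)))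
               (∀-mono (∀⁻-ty o∀) (∧-map (stable-⊃ˡ oM oψ (negF-stable F φ oφ)) (⊃-¬¬ʳ oM oψ))))

  code-in-comprehension : ∀ {P : ℕ → Set} k i X φ → All P (constsF (compAx k i X φ)) → P (code (k , i , X , φ))
  code-in-comprehension k i [] φ (p ∷ _) = p
  code-in-comprehension k i (x ∷ X) φ (p ∷ _) = p

  via-shape : ∀ f {A} → Axiom int A → Typed A → AxiomShape A → constsF A ≡ [] → ⊢ negF (suc f) A
  via-shape f {A} a o sh e = mp (axiom a o) (shape⇒negF (suc f) o sh e)

  axiom-translation : ∀ f {A} → FuelBound (suc f) A → Axiom cl A → Typed A → ⊢ negF (suc f) A
  axiom-translation f bd (comp k i X φ X-typed φ-elem φ-free) o =
    comprehension-translation f k i X φ X-typed φ-elem φ-free (code-in-comprehension k i X φ bd) o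
  axiom-translation f _ (lk φ ψ) o = ⊢K (typed-negF {F} {φ} (⊃⁻ˡ o)) (typed-negF {F} {ψ} (⊃⁻ˡ (⊃⁻ʳ o)))
    where F = suc f
  axiom-translation f _ (ls φ ψ χ) o =
    ⊢S (typed-negF {F} {φ} (⊃⁻ˡ (⊃⁻ˡ o))) (typed-negF {F} {ψ} (⊃⁻ʳ (⊃⁻ˡ o)))
       (typed-negF {F} {χ} (⊃⁻ʳ (⊃⁻ʳ (⊃⁻ʳ o))))
    where F = suc f
  axiom-translation f _ (land1 φ ψ) o = axiom (land1 _ _) (typed-negF {suc f} {φ ∧' ψ ⊃ φ} o)
  axiom-translation f _ (land2 φ ψ) o = axiom (land2 _ _) (typed-negF {suc f} {φ ∧' ψ ⊃ ψ} o)
  axiom-translation f _ (land3 φ ψ) o = axiom (land3 _ _) (typed-negF {suc f} {φ ⊃ ψ ⊃ φ ∧' ψ} o)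
  axiom-translation f _ (lor1 φ ψ) o = ⊃-trans (axiom (lor1 _ _) (⊃⁺ a (∨⁺ a b))) (¬¬-intro (∨⁺ a b))
    where a = typed-negF {suc f} {φ} (⊃⁻ˡ o) ; b = typed-negF {suc f} {ψ} (∨⁻ʳ (⊃⁻ʳ o))
  axiom-translation f _ (lor2 φ ψ) o = ⊃-trans (axiom (lor2 _ _) (⊃⁺ b (∨⁺ a b))) (¬¬-intro (∨⁺ a b))
    where a = typed-negF {suc f} {φ} (∨⁻ˡ (⊃⁻ʳ o)) ; b = typed-negF {suc f} {ψ} (⊃⁻ˡ o)
  axiom-translation f _ (lor3 φ ψ χ) o =
    ∨-elim-¬¬ (typed-negF {suc f} {φ} (⊃⁻ˡ (⊃⁻ˡ o))) (typed-negF {suc f} {ψ} (⊃⁻ˡ (⊃⁻ˡ (⊃⁻ʳ o))))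
              (typed-negF {suc f} {χ} (⊃⁻ʳ (⊃⁻ˡ o))) (negF-stable (suc f) χ (⊃⁻ʳ (⊃⁻ˡ o)))
  axiom-translation f _ (lbot φ) o = axiom (lbot _) (typed-negF {suc f} {⊥' ⊃ φ} o)
  axiom-translation f _ (lall r i φ t ff) o =
    transport (λ X → ⊢ ∀' r i (negF F φ) ⊃ X) (sym (negF-subst F r i t φ))
      (∀-inst (negT F t) (transport T (sym (negF-freeFor F r i t φ)) ff) (typed-negF {F} {∀' r i φ} (⊃⁻ˡ o)))
    where F = suc f
  axiom-translation f _ (lex r i φ t ff) o =
    transport (λ X → ⊢ X ⊃ ¬' ¬' ∃' r i (negF F φ)) (sym (negF-subst F r i t φ))
      (⊃-trans (∃-intro (negT F t) (transport T (sym (negF-freeFor F r i t φ)) ff) e) (¬¬-intro e))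
    where F = suc f
          e = ∃⁺ {r} {i} (∃⁻-ty (⊃⁻ʳ o)) (typed-negF {F} {φ} (∃⁻ (⊃⁻ʳ o)))
  axiom-translation f _ (lem _ φ) o = ¬¬-excluded-middle (typed-negF {suc f} {φ} (∨⁻ˡ o))
  axiom-translation f _ (e-refl x) o = via-shape f (e-refl x) o (pos (eq _ _ _)) refl
  axiom-translation f _ (e-name k n u v X Y) o =
    via-shape f (e-name k n u v X Y) o (imp (eq _ _ _ ∧ᵖ (eq _ _ _ ∧ᵖ eq _ _ _)) (eq _ _ _)) refl
  axiom-translation f _ (e-num1 u v m) o = via-shape f (e-num1 u v m) o (imp (eq _ _ _ ∧ᵖ eq _ _ _) (eq _ _ _)) refl
  axiom-translation f _ (e-num2 u v m) o = via-shape f (e-num2 u v m) o (imp (eq _ _ _ ∧ᵖ eq _ _ _) (eq _ _ _)) refl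
  axiom-translation f _ (e-ap f′ x y g u v) o =
    via-shape f (e-ap f′ x y g u v) o (imp (ap _ _ _ ∧ᵖ (eq _ _ _ ∧ᵖ (eq _ _ _ ∧ᵖ eq _ _ _))) (ap _ _ _)) refl
  axiom-translation f _ (e-mem k X Y U Z) o =
    via-shape f (e-mem k X Y U Z) o (imp (mem _ _ _ ∧ᵖ (positive-EqT _ _ _ ∧ᵖ positive-EqT _ _ _)) (mem _ _ _)) refl
  axiom-translation f _ (c-ap f′ x y z) o = via-shape f (c-ap f′ x y z) o (imp (ap _ _ _ ∧ᵖ ap _ _ _) (eq _ _ _)) refl
  axiom-translation f _ (c-k x y) o = via-shape f (c-k x y) o (pos (positive-≃ _ _)) refl
  axiom-translation f _ (c-s↓ x y) o = via-shape f (c-s↓ x y) o (pos (positive-↓ _)) refl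
  axiom-translation f _ (c-s x y z) o =
    via-shape f (c-s x y z) o
      (∀ₛ (imp (positive-≃ _ _) (positive-≃ _ _) ∧ₛ imp (positive-≃ _ _) (positive-≃ _ _))) refl
  axiom-translation f _ (c-p↓ x y) o = via-shape f (c-p↓ x y) o (pos (positive-↓ _)) refl
  axiom-translation f _ (c-p0 x y) o = via-shape f (c-p0 x y) o (imp (positive-≃ₑ _ _) bot) refl
  axiom-translation f _ (c-p1↓ x) o = via-shape f (c-p1↓ x) o (pos (positive-↓ _)) refl
  axiom-translation f _ (c-p2↓ x) o = via-shape f (c-p2↓ x) o (pos (positive-↓ _)) refl
  axiom-translation f _ (c-p1 x₁ x₂) o = via-shape f (c-p1 x₁ x₂) o (pos (positive-≃ _ _)) refl
  axiom-translation f _ (c-p2 x₁ x₂) o = via-shape f (c-p2 x₁ x₂) o (pos (positive-≃ _ _)) refl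
  axiom-translation f _ (c-suc n) o = via-shape f (c-suc n) o (pos (∃ᵖ (positive-≃ₑ _ _))) refl
  axiom-translation f _ (c-pk k x Y) o = via-shape f (c-pk k x Y) o (pos (∃ᵖ (positive-≃ₑ _ _))) refl
  axiom-translation f _ (c-d= x y n m) o =
    via-shape f (c-d= x y n m) o (imp (positive-EqT _ _ _) (positive-≃ _ _)) refl
  axiom-translation f _ (c-d≠ x y n m) o =
    via-shape f (c-d≠ x y n m) o (neg-imp (positive-EqT _ _ _) (positive-≃ _ _)) refl
  axiom-translation f _ (c-nameN n) o = via-shape f (c-nameN n) o (pos (∃ᵖ (eq _ _ _))) refl
  axiom-translation f _ (c-nameK k Y) o = via-shape f (c-nameK k Y) o (pos (∃ᵖ (eq _ _ _))) refl

NumEq : ℕ → ℕ → ℕ → Formula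
NumEq W a b = ∃' (tp 0) W (Eq0 ω (var W) (var {ω} a) ∧' Eq0 ω (var W) (var {ω} b))

NumEq-notFree : ∀ W a b r j → sameVar r j ω a ≡ false → sameVar r j ω b ≡ false → isFree r j (NumEq W a b) ≡ false
NumEq-notFree W a b r j j≢a j≢b with sameVar (tp 0) W r j in e
... | true = refl
... | false = ∨-false (∨-false j≢W j≢a) (∨-false j≢W j≢b)
  where j≢W = trans (sameVar-sym r j (tp 0) W) e

NumEq-tp0-closed : ∀ W a b j → isFree (tp 0) j (NumEq W a b) ≡ false
NumEq-tp0-closed W a b j = NumEq-notFree W a b (tp 0) j refl refl

module NumericalEquality (G : GodelNumbering) (s : ℕ) where
  open BT G
  open Derivations G s
  open Intuitionistic G s

  typed-NumEq : ∀ W a b → Typed (NumEq W a b)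
  typed-NumEq W a b = typed tt

  NumEq-sym : ∀ W a b → ⊢ NumEq W a b ⊃ NumEq W b a
  NumEq-sym W a b = ∃-mono tt (∧-intro g (∧-elimʳ g (hyp g (# 0))) (∧-elimˡ g (hyp g (# 0))))
    where g = ε ▸ typed tt

  NumEq-trivial : ∀ {W a b A} → Typed A → ⊢ NumEq W a b ⊃ A ⊃ A
  NumEq-trivial a = mp (⊢I a) (⊢K (⊃⁺ a a) (typed tt))

  NumEq-Eq0-var : ∀ W a b u → sameVar (tp 0) W (tp 0) u ≡ false →
                  ⊢ NumEq W a b ⊃ Eq0 ω (var {tp 0} u) (var {ω} a) ⊃ Eq0 ω (var u) (var {ω} b)
  NumEq-Eq0-var W a b u W≢u = ∃-elim (notFree (∨-false (∨-false W≢u refl) (∨-false W≢u refl))) tt body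
    where
      g = ε ▸ typed tt ▸ typed tt
      body : ⊢ (Eq0 ω (var W) (var {ω} a) ∧' Eq0 ω (var W) (var {ω} b)) ⊃
               Eq0 ω (var {tp 0} u) (var {ω} a) ⊃ Eq0 ω (var u) (var {ω} b)
      body = use g (axiom (e-num2 W u b) (typed tt))
               (∧-intro g (∧-elimʳ g (hyp g (# 1)))
                          (use g (axiom (e-num1 W u a) (typed tt)) (∧-intro g (∧-elimˡ g (hyp g (# 1))) (hyp g (# 0)))))

  NumEq-Eq0 : ∀ W a b (x : Term (tp 0)) → maxT x < W →
              ⊢ NumEq W a b ⊃ Eq0 ω x (var {ω} a) ⊃ Eq0 ω x (var {ω} b)
  NumEq-Eq0 W a b (var u) u<W = NumEq-Eq0-var W a b u (sameVar-≢ (tp 0) W (tp 0) u (λ _ W≡u → <⇒≢ u<W (sym W≡u)))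
  NumEq-Eq0 W a b (con c) _ =
    transport ⊢_ instance-c
      (instantiate {tp 0} {suc W} tt (NumEq-Eq0-var W a b (suc W) (sameVar-≢ (tp 0) W (tp 0) (suc W) (λ _ → <⇒≢ (n<1+n W))))
                   (con c) (Equivalence.from T-≡ (freeFor-closed (tp 0) (suc W) (con c) generic (λ _ _ → refl))))
    where
      generic = NumEq W a b ⊃ Eq0 ω (var {tp 0} (suc W)) (var {ω} a) ⊃ Eq0 ω (var (suc W)) (var {ω} b)
      instance-c : subst (tp 0) (suc W) (con c) generic ≡ (NumEq W a b ⊃ Eq0 ω (con c) (var {ω} a) ⊃ Eq0 ω (con c) (var {ω} b))
      instance-c rewrite subst-notFree (tp 0) (suc W) (con c) (NumEq W a b) (NumEq-tp0-closed W a b (suc W))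
                       | substT-hit (tp 0) (suc W) (con c) = refl

  leibniz-∀ : ∀ W r j Ba Bb a b → sameVar r j ω a ≡ false → sameVar r j ω b ≡ false → T (tyOK s r) → Typed Ba →
              ⊢ NumEq W a b ⊃ Ba ⊃ Bb → ⊢ NumEq W a b ⊃ ∀' r j Ba ⊃ ∀' r j Bb
  leibniz-∀ W r j Ba Bb a b j≢a j≢b tr oa ih = use₂ g curried (hyp g (# 1)) (hyp g (# 0))
    where
      o∀ = ∀⁺ {r} {j} tr oa
      g = ε ▸ typed-NumEq W a b ▸ o∀
      g′ = ε ▸ ∧⁺ (typed-NumEq W a b) o∀
      body : ⊢ NumEq W a b ∧' ∀' r j Ba ⊃ ∀' r j Bb
      body = ∀-gen (NotFree-∧ (notFree (NumEq-notFree W a b r j j≢a j≢b)) (NotFree-∀ r j Ba)) tr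
               (use₂ g′ ih (∧-elimˡ g′ (hyp g′ (# 0))) (use g′ (∀-elim o∀) (∧-elimʳ g′ (hyp g′ (# 0)))))
      curried = use g body (∧-intro g (hyp g (# 1)) (hyp g (# 0)))

  leibniz-∃ : ∀ W r j Ba Bb a b → sameVar r j ω a ≡ false → sameVar r j ω b ≡ false → T (tyOK s r) → Typed Ba →
              ⊢ NumEq W a b ⊃ Ba ⊃ Bb → ⊢ NumEq W a b ⊃ ∃' r j Ba ⊃ ∃' r j Bb
  leibniz-∃ W r j Ba Bb a b j≢a j≢b tr oa ih = app g (use g swapped (hyp g (# 0))) (hyp g (# 1))
    where
      o∃b = ∃⁺ {r} {j} tr (⊃⁻ʳ (⊃⁻ʳ (typed-⊢ ih)))
      g = ε ▸ typed-NumEq W a b ▸ ∃⁺ {r} {j} tr oa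
      g′ = ε ▸ oa ▸ typed-NumEq W a b
      swapped : ⊢ ∃' r j Ba ⊃ NumEq W a b ⊃ ∃' r j Bb
      swapped = ∃-elim (NotFree-⊃ (notFree (NumEq-notFree W a b r j j≢a j≢b)) (NotFree-∃ r j Bb)) tr
                  (use g′ (∃-intro-var o∃b) (use₂ g′ ih (hyp g′ (# 0)) (hyp g′ (# 1))))

  substT-ω-on-tp : ∀ z (t : Term ω) {k} (u : Term (tp k)) → substT ω z t u ≡ u
  substT-ω-on-tp z t u = substT-otherType ω z t u (λ ())

  NumEq-leibniz : ∀ W z χ a b → maxF χ < W → freeFor ω z (var {ω} a) χ ≡ true → freeFor ω z (var {ω} b) χ ≡ true →
                  Typed χ → ⊢ NumEq W a b ⊃ subst ω z (var a) χ ⊃ subst ω z (var b) χ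
  NumEq-leibniz W z (Ap x y w) a b lt fa fb o
    rewrite substT-ω-on-tp z (var a) x | substT-ω-on-tp z (var a) y | substT-ω-on-tp z (var a) w
          | substT-ω-on-tp z (var b) x | substT-ω-on-tp z (var b) y | substT-ω-on-tp z (var b) w = NumEq-trivial o
  NumEq-leibniz W z (Eq0 (tp k) x y) a b lt fa fb o
    rewrite substT-ω-on-tp z (var a) x | substT-ω-on-tp z (var a) y | substT-ω-on-tp z (var b) x | substT-ω-on-tp z (var b) y = NumEq-trivial o
  NumEq-leibniz W z (Eq0 ω x zer) a b lt fa fb o rewrite substT-ω-on-tp z (var a) x | substT-ω-on-tp z (var b) x = NumEq-trivial o
  NumEq-leibniz W z (Eq0 ω x (var j)) a b lt fa fb o rewrite substT-ω-on-tp z (var a) x | substT-ω-on-tp z (var b) x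
    with sameVar ω z ω j in e
  ... | true = NumEq-Eq0 W a b x (m⊔n<o⇒m<o _ _ lt)
  ... | false = NumEq-trivial o
  NumEq-leibniz W z (Mem k x y) a b lt fa fb o
    rewrite substT-ω-on-tp z (var a) x | substT-ω-on-tp z (var a) y | substT-ω-on-tp z (var b) x | substT-ω-on-tp z (var b) y = NumEq-trivial o
  NumEq-leibniz W z ⊥' a b lt fa fb o = NumEq-trivial ⊥⁺
  NumEq-leibniz W z (A ∧' B) a b lt fa fb o =
    ∧-intro g (use₂ g (NumEq-leibniz W z A a b (m⊔n<o⇒m<o _ _ lt) (∧-conicalˡ _ _ fa) (∧-conicalˡ _ _ fb) (∧⁻ˡ o))
                      (hyp g (# 1)) (∧-elimˡ g (hyp g (# 0))))
              (use₂ g (NumEq-leibniz W z B a b (m⊔n<o⇒n<o _ _ lt) (∧-conicalʳ (freeFor ω z (var a) A) _ fa)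
                                     (∧-conicalʳ (freeFor ω z (var b) A) _ fb) (∧⁻ʳ o))
                      (hyp g (# 1)) (∧-elimʳ g (hyp g (# 0))))
    where g = ε ▸ typed-NumEq W a b ▸ ∧⁺ (typed-subst (var a) (∧⁻ˡ o)) (typed-subst (var a) (∧⁻ʳ o))
  NumEq-leibniz W z (A ∨' B) a b lt fa fb o = ∨-elim g (hyp g (# 0)) left right
    where
      oA = ∨⁻ˡ o ; oB = ∨⁻ʳ o
      oAa = typed-subst {ω} {z} {A} (var a) oA ; oBa = typed-subst {ω} {z} {B} (var a) oB
      g = ε ▸ typed-NumEq W a b ▸ ∨⁺ oAa oBa
      gA = g ▸ oAa
      gB = g ▸ oBa
      left = ∨-introˡ gA (typed-subst {ω} {z} {B} (var b) oB)
               (use₂ gA (NumEq-leibniz W z A a b (m⊔n<o⇒m<o _ _ lt) (∧-conicalˡ _ _ fa) (∧-conicalˡ _ _ fb) oA)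
                        (hyp gA (# 2)) (hyp gA (# 0)))
      right = ∨-introʳ gB (typed-subst {ω} {z} {A} (var b) oA)
                (use₂ gB (NumEq-leibniz W z B a b (m⊔n<o⇒n<o _ _ lt) (∧-conicalʳ (freeFor ω z (var a) A) _ fa)
                                        (∧-conicalʳ (freeFor ω z (var b) A) _ fb) oB)
                         (hyp gB (# 2)) (hyp gB (# 0)))
  NumEq-leibniz W z (A ⊃ B) a b lt fa fb o =
    use₂ g (NumEq-leibniz W z B a b (m⊔n<o⇒n<o _ _ lt) (∧-conicalʳ (freeFor ω z (var a) A) _ fa)
                          (∧-conicalʳ (freeFor ω z (var b) A) _ fb) (⊃⁻ʳ o))
      (hyp g (# 2))
      (app g (hyp g (# 1))
        (use₂ g (NumEq-leibniz W z A b a (m⊔n<o⇒m<o _ _ lt) (∧-conicalˡ _ _ fb) (∧-conicalˡ _ _ fa) (⊃⁻ˡ o))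
                (use g (NumEq-sym W a b) (hyp g (# 2))) (hyp g (# 0))))
    where g = ε ▸ typed-NumEq W a b
                ▸ ⊃⁺ (typed-subst {ω} {z} {A} (var a) (⊃⁻ˡ o)) (typed-subst {ω} {z} {B} (var a) (⊃⁻ʳ o))
                ▸ typed-subst {ω} {z} {A} (var b) (⊃⁻ˡ o)
  NumEq-leibniz W z (∀' r j B) a b lt fa fb o with sameVar r j ω z
  ... | true = NumEq-trivial o
  ... | false with isFree ω z B in z∉B
  ...   | false rewrite subst-notFree ω z (var a) B z∉B | subst-notFree ω z (var b) B z∉B = NumEq-trivial o
  ...   | true = leibniz-∀ W r j _ _ a b (not-true (∧-conicalˡ _ _ fa)) (not-true (∧-conicalˡ _ _ fb)) (∀⁻-ty o)
                   (typed-subst {ω} {z} {B} (var a) (∀⁻ o))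
                   (NumEq-leibniz W z B a b (m⊔n<o⇒n<o j _ lt) (∧-conicalʳ _ _ fa) (∧-conicalʳ _ _ fb) (∀⁻ o))
  NumEq-leibniz W z (∃' r j B) a b lt fa fb o with sameVar r j ω z
  ... | true = NumEq-trivial o
  ... | false with isFree ω z B in z∉B
  ...   | false rewrite subst-notFree ω z (var a) B z∉B | subst-notFree ω z (var b) B z∉B = NumEq-trivial o
  ...   | true = leibniz-∃ W r j _ _ a b (not-true (∧-conicalˡ _ _ fa)) (not-true (∧-conicalˡ _ _ fb)) (∃⁻-ty o)
                   (typed-subst {ω} {z} {B} (var a) (∃⁻ o))
                   (NumEq-leibniz W z B a b (m⊔n<o⇒n<o j _ lt) (∧-conicalʳ _ _ fa) (∧-conicalʳ _ _ fb) (∃⁻ o))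

-- p·a·0 ≃ₑ b unfolded (see SuccEq≡Succ), with its bound variables named X, …, X+3; PairApp a Y is p·a ≃ Y.
PairApp : ℕ → ℕ → Formula
PairApp a Y = ∃' (tp 0) (suc Y) (∃' (tp 0) (suc (suc Y))
  (Eq0 (tp 0) (var (suc Y)) (con pc) ∧' (Eq0 ω (var (suc (suc Y))) (var {ω} a) ∧' Ap (var (suc Y)) (var (suc (suc Y))) (var Y))))

SuccApp : ℕ → ℕ → Formula
SuccApp a X = ∃' (tp 0) (suc X) (∃' (tp 0) (suc (suc X))
  (PairApp a (suc X) ∧' (Eq0 ω (var (suc (suc X))) zer ∧' Ap (var (suc X)) (var (suc (suc X))) (var X))))

Succ : ℕ → ℕ → ℕ → Formula
Succ a b X = ∃' (tp 0) X (SuccApp a X ∧' Eq0 ω (var X) (var {ω} b))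

-- the hypotheses obtained by opening Succ a b X with the fresh names F, …, F+4
SuccCtx : ℕ → ℕ → ℕ → Ctx
SuccCtx a b F =
  ε ▸ Eq0 (tp 0) (var (3 + F)) (con pc) ▸ Eq0 ω (var (4 + F)) (var {ω} a) ▸ Ap (var (3 + F)) (var (4 + F)) (var (1 + F))
    ▸ Eq0 ω (var (2 + F)) zer ▸ Ap (var (1 + F)) (var (2 + F)) (var F) ▸ Eq0 ω (var F) (var {ω} b)

≡ᵇ-suc+ˡ : ∀ k X → (suc k + X ≡ᵇ X) ≡ false
≡ᵇ-suc+ˡ k X = ≢⇒≡ᵇ-false (λ e → m≢1+n+m X {k} (sym e))

≡ᵇ-suc+ʳ : ∀ k X → (X ≡ᵇ suc k + X) ≡ false
≡ᵇ-suc+ʳ k X = ≢⇒≡ᵇ-false (m≢1+n+m X {k})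

-- Opening Succ a b X renames its bound variables one at a time to F, …, F+4. All names are offsets of X,
-- so each side condition is decided by rewriting a few comparisons X + i ≡ᵇ X + j.
module SuccessorOpening (a b X d : ℕ) where
  F : ℕ
  F = 4 + d + X

  PairApp′ : Formula
  PairApp′ = ∃' (tp 0) (2 + X) (∃' (tp 0) (3 + X)
    (Eq0 (tp 0) (var (2 + X)) (con pc) ∧' (Eq0 ω (var (3 + X)) (var {ω} a) ∧' Ap (var (2 + X)) (var (3 + X)) (var (1 + F)))))
  Pair-App : Formula
  Pair-App = Eq0 (tp 0) (var (3 + F)) (con pc) ∧' (Eq0 ω (var (4 + F)) (var {ω} a) ∧' Ap (var (3 + F)) (var (4 + F)) (var (1 + F)))
  Zero-App : Formula
  Zero-App = Eq0 ω (var (2 + F)) zer ∧' Ap (var (1 + F)) (var (2 + F)) (var F)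
  Is-b : Formula
  Is-b = Eq0 ω (var F) (var {ω} b)

  Body₁ : Formula
  Body₁ = SuccApp a X ∧' Eq0 ω (var X) (var {ω} b)
  Body₂ : Formula
  Body₂ = ∃' (tp 0) (2 + X) (PairApp a (1 + X) ∧' (Eq0 ω (var (2 + X)) zer ∧' Ap (var (1 + X)) (var (2 + X)) (var F)))
  Body₃ : Formula
  Body₃ = PairApp′ ∧' (Eq0 ω (var (2 + X)) zer ∧' Ap (var (1 + F)) (var (2 + X)) (var F))
  Body₄ : Formula
  Body₄ = ∃' (tp 0) (3 + X)
    (Eq0 (tp 0) (var (2 + X)) (con pc) ∧' (Eq0 ω (var (3 + X)) (var {ω} a) ∧' Ap (var (2 + X)) (var (3 + X)) (var (1 + F))))
  Body₅ : Formula
  Body₅ = Eq0 (tp 0) (var (3 + F)) (con pc) ∧' (Eq0 ω (var (3 + X)) (var {ω} a) ∧' Ap (var (3 + F)) (var (3 + X)) (var (1 + F)))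

  renamed₁ : subst (tp 0) X (var F) Body₁ ≡ ∃' (tp 0) (1 + X) Body₂ ∧' Is-b
  renamed₁ rewrite ≡ᵇ-refl X | ≡ᵇ-suc+ˡ 0 X | ≡ᵇ-suc+ʳ 0 X | ≡ᵇ-suc+ˡ 1 X | ≡ᵇ-suc+ʳ 1 X
                 | ≡ᵇ-suc+ˡ 2 X | ≡ᵇ-suc+ʳ 2 X = refl
  renamed₂ : subst (tp 0) (1 + X) (var (1 + F)) Body₂ ≡ ∃' (tp 0) (2 + X) Body₃
  renamed₂ rewrite ≡ᵇ-refl X | ≡ᵇ-suc+ˡ 0 X | ≡ᵇ-suc+ʳ 0 X | ≡ᵇ-suc+ˡ 1 X | ≡ᵇ-suc+ʳ 1 X
                 | ≡ᵇ-suc+ʳ (2 + d) X = refl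
  renamed₃ : subst (tp 0) (2 + X) (var (2 + F)) Body₃ ≡ PairApp′ ∧' Zero-App
  renamed₃ rewrite ≡ᵇ-refl X | ≡ᵇ-suc+ʳ (1 + d) X | ≡ᵇ-suc+ʳ (2 + d) X = refl
  renamed₄ : subst (tp 0) (2 + X) (var (3 + F)) Body₄ ≡ ∃' (tp 0) (3 + X) Body₅
  renamed₄ rewrite ≡ᵇ-refl X | ≡ᵇ-suc+ˡ 0 X | ≡ᵇ-suc+ʳ 0 X | ≡ᵇ-suc+ʳ (2 + d) X = refl
  renamed₅ : subst (tp 0) (3 + X) (var (4 + F)) Body₅ ≡ Pair-App
  renamed₅ rewrite ≡ᵇ-refl X | ≡ᵇ-suc+ʳ (1 + d) X | ≡ᵇ-suc+ʳ (3 + d) X = refl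

  absent₁ : absent (tp 0) F Body₁ ≡ true
  absent₁ rewrite ≡ᵇ-suc+ˡ d X | ≡ᵇ-suc+ˡ (1 + d) X | ≡ᵇ-suc+ˡ (2 + d) X | ≡ᵇ-suc+ˡ (3 + d) X = refl
  absent₂ : absent (tp 0) (1 + F) Body₂ ≡ true
  absent₂ rewrite ≡ᵇ-suc+ˡ 0 (d + X) | ≡ᵇ-suc+ˡ (1 + d) X | ≡ᵇ-suc+ˡ (2 + d) X | ≡ᵇ-suc+ˡ (3 + d) X = refl
  absent₃ : absent (tp 0) (2 + F) Body₃ ≡ true
  absent₃ rewrite ≡ᵇ-suc+ˡ 0 (d + X) | ≡ᵇ-suc+ˡ 1 (d + X) | ≡ᵇ-suc+ˡ (2 + d) X | ≡ᵇ-suc+ˡ (3 + d) X = refl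
  absent₄ : absent (tp 0) (3 + F) Body₄ ≡ true
  absent₄ rewrite ≡ᵇ-suc+ˡ 1 (d + X) | ≡ᵇ-suc+ˡ (3 + d) X | ≡ᵇ-suc+ˡ (4 + d) X = refl
  absent₅ : absent (tp 0) (4 + F) Body₅ ≡ true
  absent₅ rewrite ≡ᵇ-suc+ˡ 0 (d + X) | ≡ᵇ-suc+ˡ 2 (d + X) | ≡ᵇ-suc+ˡ (4 + d) X = refl

  distinct₁ : sameVar (tp 0) X (tp 0) F ≡ false
  distinct₁ rewrite ≡ᵇ-suc+ʳ (3 + d) X = refl
  distinct₂ : sameVar (tp 0) (1 + X) (tp 0) (1 + F) ≡ false
  distinct₂ rewrite ≡ᵇ-suc+ʳ (3 + d) X = refl
  distinct₃ : sameVar (tp 0) (2 + X) (tp 0) (2 + F) ≡ false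
  distinct₃ rewrite ≡ᵇ-suc+ʳ (3 + d) X = refl
  distinct₄ : sameVar (tp 0) (2 + X) (tp 0) (3 + F) ≡ false
  distinct₄ rewrite ≡ᵇ-suc+ʳ (4 + d) X = refl
  distinct₅ : sameVar (tp 0) (3 + X) (tp 0) (4 + F) ≡ false
  distinct₅ rewrite ≡ᵇ-suc+ʳ (4 + d) X = refl

  Is-b-fresh₁ : isFree (tp 0) (1 + F) Is-b ≡ false
  Is-b-fresh₁ rewrite ≡ᵇ-suc+ˡ 0 (d + X) = refl
  Is-b-fresh₂ : isFree (tp 0) (2 + F) Is-b ≡ false
  Is-b-fresh₂ rewrite ≡ᵇ-suc+ˡ 1 (d + X) = refl
  Is-b-fresh₃ : isFree (tp 0) (3 + F) Is-b ≡ false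
  Is-b-fresh₃ rewrite ≡ᵇ-suc+ˡ 2 (d + X) = refl
  Is-b-fresh₄ : isFree (tp 0) (4 + F) Is-b ≡ false
  Is-b-fresh₄ rewrite ≡ᵇ-suc+ˡ 3 (d + X) = refl
  Zero-App-fresh₃ : isFree (tp 0) (3 + F) Zero-App ≡ false
  Zero-App-fresh₃ rewrite ≡ᵇ-suc+ˡ 0 (d + X) | ≡ᵇ-suc+ˡ 1 (d + X) | ≡ᵇ-suc+ˡ 2 (d + X) = refl
  Zero-App-fresh₄ : isFree (tp 0) (4 + F) Zero-App ≡ false
  Zero-App-fresh₄ rewrite ≡ᵇ-suc+ˡ 1 (d + X) | ≡ᵇ-suc+ˡ 2 (d + X) | ≡ᵇ-suc+ˡ 3 (d + X) = refl

module Successor (G : GodelNumbering) (s : ℕ) where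
  open BT G
  open Derivations G s
  open Intuitionistic G s
  open NumericalEquality G s

  Succ-open : ∀ a b X d D →
    (∀ {e} → e ≤ 4 → NotFree (tp 0) (e + (4 + d + X)) D) →
    ⊢ SuccCtx a b (4 + d + X) ⇛ D → ⊢ Succ a b X ⊃ D
  Succ-open a b X d D fresh hyps =
    ∃-elim-rename _ renamed₁ absent₁ distinct₁ (fresh z≤n) (typed tt) (∧-curry⁻
    (∃-elim-rename _ renamed₂ absent₂ distinct₂ (NotFree-⊃ (notFree Is-b-fresh₁) (fresh (s≤s z≤n))) (typed tt)
    (∃-elim-rename _ renamed₃ absent₃ distinct₃ (NotFree-⊃ (notFree Is-b-fresh₂) (fresh (s≤s (s≤s z≤n)))) (typed tt)
    (∧-curry⁻
    (∃-elim-rename _ renamed₄ absent₄ distinct₄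
                   (fresh₃ Zero-App-fresh₃ Is-b-fresh₃ (fresh (s≤s (s≤s (s≤s z≤n))))) (typed tt)
    (∃-elim-rename _ renamed₅ absent₅ distinct₅
                   (fresh₃ Zero-App-fresh₄ Is-b-fresh₄ (fresh (s≤s (s≤s (s≤s (s≤s z≤n)))))) (typed tt)
      regroup))))))
    where
      open SuccessorOpening a b X d
      fresh₃ : ∀ {j A B C} → isFree (tp 0) j A ≡ false → isFree (tp 0) j B ≡ false → NotFree (tp 0) j C →
               NotFree (tp 0) j (A ⊃ B ⊃ C)
      fresh₃ a b c = NotFree-⊃ (notFree a) (NotFree-⊃ (notFree b) c)
      g = ε ▸ typed tt ▸ typed tt ▸ typed tt
      regroup : ⊢ Pair-App ⊃ Zero-App ⊃ Is-b ⊃ D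
      regroup = app g (app g (app g (app g (app g (app g (lift g hyps)
                  (∧-elimˡ g (hyp g (# 2))))
                  (∧-elimˡ g (∧-elimʳ g (hyp g (# 2)))))
                  (∧-elimʳ g (∧-elimʳ g (hyp g (# 2)))))
                  (∧-elimˡ g (hyp g (# 1))))
                  (∧-elimʳ g (hyp g (# 1))))
                  (hyp g (# 0))

Succ-tp0-closed : ∀ a b X j → isFree (tp 0) j (Succ a b X) ≡ false
Succ-tp0-closed a b X j =
  under X (SuccApp a X ∧' Eq0 ω (var X) (var {ω} b)) (λ j≢X → ∨-false (SuccApp-closed j≢X) (∨-false (occ X j≢X) refl))
  where
    under : ∀ i B → (sameVar (tp 0) i (tp 0) j ≡ false → isFree (tp 0) j B ≡ false) →
            isFree (tp 0) j (∃' (tp 0) i B) ≡ false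
    under i B f with sameVar (tp 0) i (tp 0) j in e
    ... | true = refl
    ... | false = f refl
    occ : ∀ i → sameVar (tp 0) i (tp 0) j ≡ false → occT (tp 0) j (var {tp 0} i) ≡ false
    occ i e = trans (sameVar-sym (tp 0) j (tp 0) i) e
    PairBody = Eq0 (tp 0) (var (2 + X)) (con pc) ∧' (Eq0 ω (var (3 + X)) (var {ω} a) ∧' Ap (var (2 + X)) (var (3 + X)) (var (1 + X)))
    SuccBody = PairApp a (1 + X) ∧' (Eq0 ω (var (2 + X)) zer ∧' Ap (var (1 + X)) (var (2 + X)) (var X))
    PairApp-closed : sameVar (tp 0) (1 + X) (tp 0) j ≡ false → isFree (tp 0) j (PairApp a (1 + X)) ≡ false
    PairApp-closed j≢X₁ = under (2 + X) (∃' (tp 0) (3 + X) PairBody) λ j≢X₂ → under (3 + X) PairBody λ j≢X₃ →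
      ∨-false (∨-false (occ (2 + X) j≢X₂) refl)
              (∨-false (∨-false (occ (3 + X) j≢X₃) refl)
                       (∨-false (occ (2 + X) j≢X₂) (∨-false (occ (3 + X) j≢X₃) (occ (1 + X) j≢X₁))))
    SuccApp-closed : sameVar (tp 0) X (tp 0) j ≡ false → isFree (tp 0) j (SuccApp a X) ≡ false
    SuccApp-closed j≢X = under (1 + X) (∃' (tp 0) (2 + X) SuccBody) λ j≢X₁ → under (2 + X) SuccBody λ j≢X₂ →
      ∨-false (PairApp-closed j≢X₁)
              (∨-false (∨-false (occ (2 + X) j≢X₂) refl)
                       (∨-false (occ (1 + X) j≢X₁) (∨-false (occ (2 + X) j≢X₂) (occ X j≢X))))

SuccCtx-fresh : ∀ a b F D j → (∀ {c} → c ≤ 4 → (j ≡ᵇ c + F) ≡ false) → isFree (tp 0) j D ≡ false →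
                isFree (tp 0) j (SuccCtx a b F ⇛ D) ≡ false
SuccCtx-fresh a b F D j j∉F j∉D
  rewrite j∉F z≤n | j∉F (s≤s z≤n) | j∉F (s≤s (s≤s z≤n)) | j∉F (s≤s (s≤s (s≤s z≤n)))
        | j∉F (s≤s (s≤s (s≤s (s≤s z≤n)))) | j∉D = refl

module SuccessorUniqueness (G : GodelNumbering) (s : ℕ) where
  open BT G
  open Derivations G s
  open Intuitionistic G s
  open NumericalEquality G s
  open Successor G s

  Eq0-pc-unique : ∀ u v → ⊢ Eq0 (tp 0) (var v) (con pc) ⊃ Eq0 (tp 0) (var u) (con pc) ⊃ Eq0 (tp 0) (var u) (var v)
  Eq0-pc-unique u v = use g names-pc (∧-intro g (hyp g (# 1)) (∧-intro g (hyp g (# 0)) (lift g (axiom (e-refl v) (typed tt)))))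
    where
      Y = suc (u ⊔ v)
      generic = Eq0 (tp 0) (var v) (var Y) ∧' Eq0 (tp 0) (var u) (var Y) ∧' Eq0 (tp 0) (var v) (var v) ⊃ Eq0 (tp 0) (var u) (var v)
      at-pc : subst (tp 0) Y (con pc) generic ≡
              (Eq0 (tp 0) (var v) (con pc) ∧' Eq0 (tp 0) (var u) (con pc) ∧' Eq0 (tp 0) (var v) (var v) ⊃ Eq0 (tp 0) (var u) (var v))
      at-pc rewrite ≡ᵇ-refl (u ⊔ v)
                  | ≢⇒≡ᵇ-false {Y} {u} (λ e → <⇒≢ (s≤s (m≤m⊔n u v)) (sym e))
                  | ≢⇒≡ᵇ-false {Y} {v} (λ e → <⇒≢ (s≤s (m≤n⊔m u v)) (sym e)) = refl
      names-pc = transport ⊢_ at-pc (instantiate {tp 0} {Y} tt (axiom (e-name 0 0 v u Y v) (typed tt)) (con pc)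
                   (Equivalence.from T-≡ (freeFor-closed (tp 0) Y (con pc) generic (λ _ _ → refl))))
      g = ε ▸ typed tt ▸ typed tt

  Eq0-zero-unique : ∀ u v → ⊢ Eq0 ω (var u) zer ∧' Eq0 ω (var v) zer ⊃ Eq0 (tp 0) (var u) (var v)
  Eq0-zero-unique u v =
    instantiate {ω} {0} tt (axiom (e-num1 u v 0) (typed tt)) zer
      (Equivalence.from T-≡ (freeFor-closed ω 0 zer generic (λ _ _ → refl)))
    where generic = Eq0 ω (var u) (var {ω} 0) ∧' Eq0 ω (var v) (var {ω} 0) ⊃ Eq0 (tp 0) (var u) (var v)


  typed-SuccCtx : ∀ a b F → TypedCtx (SuccCtx a b F)
  typed-SuccCtx a b F = ε ▸ typed tt ▸ typed tt ▸ typed tt ▸ typed tt ▸ typed tt ▸ typed tt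

  -- Ap is functional and p, n, 0 have unique names, so both opened copies compute the same value.
  SuccCtx-agree : ∀ n a b F₁ F₂ W → ⊢ SuccCtx n b F₂ ⇛ (SuccCtx n a F₁ ⇛ NumEq W a b)
  SuccCtx-agree n a b F₁ F₂ W = use g witness-F₁ (∧-intro g (hyp g (# 0)) F₁-is-b)
    where
      witness-F₁ : ⊢ Eq0 ω (var F₁) (var {ω} a) ∧' Eq0 ω (var F₁) (var {ω} b) ⊃ NumEq W a b
      witness-F₁ rewrite sym (cong (λ c → if c then var {tp 0} F₁ else var W) (≡ᵇ-refl W)) = ∃-intro (var F₁) tt (typed tt)
      g = ε ▸ typed tt ▸ typed tt ▸ typed tt ▸ typed tt ▸ typed tt ▸ typed tt
            ▸ typed tt ▸ typed tt ▸ typed tt ▸ typed tt ▸ typed tt ▸ typed tt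
      refl₀ = λ u → lift g (axiom (e-refl u) (typed tt))
      pc-names = use₂ g (Eq0-pc-unique (3 + F₁) (3 + F₂)) (hyp g (# 11)) (hyp g (# 5))
      n-names = use g (axiom (e-num1 (4 + F₁) (4 + F₂) n) (typed tt)) (∧-intro g (hyp g (# 4)) (hyp g (# 10)))
      pair₁-at-F₂ = use g (axiom (e-ap (3 + F₁) (4 + F₁) (1 + F₁) (3 + F₂) (4 + F₂) (1 + F₁)) (typed tt))
                      (∧-intro g (hyp g (# 3)) (∧-intro g pc-names (∧-intro g n-names (refl₀ (1 + F₁)))))
      pairs-agree = use g (axiom (c-ap (3 + F₂) (4 + F₂) (1 + F₁) (1 + F₂)) (typed tt)) (∧-intro g pair₁-at-F₂ (hyp g (# 9)))
      zeros = use g (Eq0-zero-unique (2 + F₁) (2 + F₂)) (∧-intro g (hyp g (# 2)) (hyp g (# 8)))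
      succ₁-at-F₂ = use g (axiom (e-ap (1 + F₁) (2 + F₁) F₁ (1 + F₂) (2 + F₂) F₁) (typed tt))
                      (∧-intro g (hyp g (# 1)) (∧-intro g pairs-agree (∧-intro g zeros (refl₀ F₁))))
      succs-agree = use g (axiom (c-ap (1 + F₂) (2 + F₂) F₂ F₁) (typed tt)) (∧-intro g (hyp g (# 7)) succ₁-at-F₂)
      F₁-is-b = use g (axiom (e-num2 F₂ F₁ b) (typed tt)) (∧-intro g (hyp g (# 6)) succs-agree)

  Succ-unique : ∀ n a b X W → ⊢ Succ n a X ⊃ Succ n b X ⊃ NumEq W a b
  Succ-unique n a b X W =
    Succ-open n a X 6 (Succ n b X ⊃ NumEq W a b) (λ _ → notFree (∨-false (Succ-tp0-closed n b X _) (NumEq-tp0-closed W a b _)))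
      (⊃-exchange (typed-SuccCtx n a F₁)
        (Succ-open n b X 11 (SuccCtx n a F₁ ⇛ NumEq W a b) fresh (SuccCtx-agree n a b F₁ (15 + X) W)))
    where
      F₁ = 10 + X
      fresh : ∀ {e} → e ≤ 4 → NotFree (tp 0) (e + (15 + X)) (SuccCtx n a F₁ ⇛ NumEq W a b)
      fresh {e} _ = notFree (SuccCtx-fresh n a F₁ (NumEq W a b) (e + (15 + X)) (λ c≤4 → ≢⇒≡ᵇ-false (apart c≤4))
                                              (NumEq-tp0-closed W a b _))
        where
          apart : ∀ {c} → c ≤ 4 → e + (15 + X) ≢ c + F₁
          apart {c} c≤4 e≡c = <⇒≢ (≤-trans (s≤s (+-monoˡ-≤ F₁ c≤4)) (m≤n+m (15 + X) e)) (sym e≡c)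

SuccEq : ℕ → ℕ → Formula
SuccEq n m = (cst pc · atm (var {ω} n) · atm zer) ≃ₑ atm (var {ω} m)

-- the name of the outermost bound variable of SuccEq n m
succName : ℕ → ℕ → ℕ
succName n m = suc ((n ⊔ 0) ⊔ m)

SuccEq≡Succ : ∀ n m → SuccEq n m ≡ Succ n m (succName n m)
SuccEq≡Succ n m = cong (λ R → ∃' (tp 0) X (R ∧' Eq0 ω (var X) (var {ω} m))) (SuccApp-canonical n X n≤X)
  where
    X = succName n m
    n≤X : n ≤ X
    n≤X = ≤-trans (≤-trans (m≤m⊔n n 0) (m≤m⊔n (n ⊔ 0) m)) (n≤1+n _)
    SuccApp-canonical : ∀ n X → n ≤ X → ((cst pc · atm (var {ω} n) · atm zer) ≃ X) ≡ SuccApp n X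
    SuccApp-canonical n X n≤X
      rewrite m≤n⇒m⊔n≡n {n ⊔ 0} {X} (transport (_≤ X) (sym (⊔-identityʳ n)) n≤X)
            | m≤n⇒m⊔n≡n {n} {suc X} (≤-trans n≤X (n≤1+n X)) = refl

Succ-ω-notFree : ∀ a b X j → (j ≡ᵇ a) ≡ false → (j ≡ᵇ b) ≡ false → isFree ω j (Succ a b X) ≡ false
Succ-ω-notFree a b X j j≢a j≢b rewrite j≢a | j≢b = refl

module Induction (G : GodelNumbering) (s : ℕ) where
  open BT G
  open Translation G
  open Derivations G s
  open Intuitionistic G s
  open PositiveTranslation G s
  open NumericalEquality G s
  open SuccessorUniqueness G s

  -- from the successor axiom for the variable k, whose bound names are those wanted, by renaming and k := n
  Succ-exists : ∀ k n v → v ≢ k → v ≢ suc k → v ≢ n → ⊢ ∃' ω v (Succ n v (2 + k))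
  Succ-exists k n v v≢k v≢k+1 v≢n =
    transport ⊢_ instantiated
      (instantiate {ω} {k} tt renamed (var n)
        (Equivalence.from T-≡ (if-false (sameVar ω v ω k) v≢ᵇk
          (freeFor-binder ω k (var n) ω v (Succ k v X) (≢⇒≡ᵇ-false v≢n)
            (freeFor-tp0Binders ω k (var n) (Succ k v X) refl (λ _ → refl))))))
    where
      X = 2 + k
      v≢ᵇk = ≢⇒≡ᵇ-false v≢k
      succName-k : succName k (suc k) ≡ X
      succName-k = cong suc (m≤n⇒m⊔n≡n {k ⊔ 0} {suc k} (transport (_≤ suc k) (sym (⊔-identityʳ k)) (n≤1+n k)))
      axiom-k : ⊢ ∃' ω (suc k) (Succ k (suc k) X)
      axiom-k = transport (λ Z → ⊢ ∃' ω (suc k) Z) (trans (SuccEq≡Succ k (suc k)) (cong (Succ k (suc k)) succName-k))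
                  (axiom (c-suc k) (typed tt))
      renamed : ⊢ ∃' ω v (Succ k v X)
      renamed = transport (λ Z → ⊢ ∃' ω v Z) renamed-body
                  (mp axiom-k (∃-rename {ω} {suc k} {v} {Succ k (suc k) X} v-absent
                                        (≢⇒≡ᵇ-false (λ e → v≢k+1 (sym e))) (typed tt)))
        where
          v-absent : absent ω v (Succ k (suc k) X) ≡ true
          v-absent rewrite v≢ᵇk | ≢⇒≡ᵇ-false v≢k+1 = refl
          renamed-body : subst ω (suc k) (var v) (Succ k (suc k) X) ≡ Succ k v X
          renamed-body rewrite ≡ᵇ-refl k | ≡ᵇ-suc+ˡ 0 k = refl
      instantiated : subst ω k (var n) (∃' ω v (Succ k v X)) ≡ ∃' ω v (Succ n v X)
      instantiated rewrite v≢ᵇk | ≡ᵇ-refl k | ≢⇒≡ᵇ-false (λ e → v≢k (sym e)) = refl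

  SuccEq⁻⇒¬¬Succ : ∀ f n m → ⊢ negF f (SuccEq n m) ⊃ ¬' ¬' Succ n m (succName n m)
  SuccEq⁻⇒¬¬Succ f n m =
    transport (λ Z → ⊢ negF f (SuccEq n m) ⊃ ¬' ¬' Z) (trans (tilde-basic f (SuccEq n m) refl) (SuccEq≡Succ n m))
      (negF⇒¬¬tilde f (typed tt) (positive-≃ₑ _ _))

  succName-≥2 : ∀ n m → n ≢ m → ∃ λ k → succName n m ≡ 2 + k
  succName-≥2 n m n≢m with (n ⊔ 0) ⊔ m in e
  ... | suc k = k , refl
  ... | zero = ⊥-elim (n≢m (trans (n≤0⇒n≡0 (transport (n ≤_) e n≤M))
                               (sym (n≤0⇒n≡0 (transport (m ≤_) e (m≤n⊔m (n ⊔ 0) m))))))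
    where n≤M = ≤-trans (m≤m⊔n n 0) (m≤m⊔n (n ⊔ 0) m)

  transfer-to-successor : ∀ f χ n m v X W → maxF χ < W → n ≢ m → v ≢ m →
    isFree ω m χ ≡ false → freeFor ω n (var m) χ ≡ true → freeFor ω n (var v) χ ≡ true → Typed χ →
    X ≡ succName n m →
    ⊢ ∃' ω m (negF f (SuccEq n m) ∧' subst ω n (var m) χ) ⊃ Succ n v X ⊃ ¬' ¬' subst ω n (var v) χ
  transfer-to-successor f χ n m v X W χ<W n≢m v≢m m∉χ m-free v-free oχ refl =
    ∃-elim (NotFree-⊃ (notFree (Succ-ω-notFree n v X m (≢⇒≡ᵇ-false (λ e → n≢m (sym e))) m≢ᵇv))
                      (NotFree-¬ (NotFree-¬ (notFree (isFree-subst-var ω m n v χ m∉χ m≢ᵇv)))))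
           tt transferred
    where
      m≢ᵇv = ≢⇒≡ᵇ-false (λ e → v≢m (sym e))
      χm = subst ω n (var m) χ
      χv = subst ω n (var v) χ
      oχv = typed-subst {ω} {n} {χ} (var v) oχ
      g : TypedCtx (ε ▸ (negF f (SuccEq n m) ∧' χm) ▸ Succ n v X)
      g = ε ▸ ∧⁺ (typed-negF {f} {SuccEq n m} (typed tt)) (typed-subst (var m) oχ) ▸ typed tt
      g′ : TypedCtx (ε ▸ (negF f (SuccEq n m) ∧' χm) ▸ Succ n v X ▸ Succ n m X)
      g′ = g ▸ typed tt
      m-to-v : ⊢ ε ▸ (negF f (SuccEq n m) ∧' χm) ▸ Succ n v X ⇛ (Succ n m X ⊃ χv)
      m-to-v = use₂ g′ (NumEq-leibniz W n χ m v χ<W m-free v-free oχ)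
                 (use₂ g′ (Succ-unique n m v X W) (hyp g′ (# 0)) (hyp g′ (# 1))) (∧-elimʳ g′ (hyp g′ (# 2)))
      transferred : ⊢ negF f (SuccEq n m) ∧' χm ⊃ Succ n v X ⊃ ¬' ¬' χv
      transferred = use₂ g (¬¬-⊃ (typed tt) oχv) (use g (¬¬-intro (⊃⁺ (typed tt) oχv)) m-to-v)
                      (use g (SuccEq⁻⇒¬¬Succ f n m) (∧-elimˡ g (hyp g (# 1))))

  -- The translated premise only yields ¬¬∃m; the successor axiom supplies a genuine witness v, to which
  -- χ[n:=m] transfers under ¬¬ by uniqueness of successors, and stability of χ[n:=v] removes the ¬¬.
  induction-step : ∀ f χ n m → n ≢ m → isFree ω m χ ≡ false → freeFor ω n (var m) χ ≡ true → Typed χ →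
    (∀ v → ⊢ ¬' ¬' subst ω n (var v) χ ⊃ subst ω n (var v) χ) →
    ⊢ χ ⊃ ¬' ¬' ∃' ω m (negF f (SuccEq n m) ∧' subst ω n (var m) χ) →
    ⊢ χ ⊃ ∃' ω m (SuccEq n m ∧' subst ω n (var m) χ)
  induction-step f χ n m n≢m m∉χ m-free oχ stable premise with succName-≥2 n m n≢m
  ... | k , X≡2+k = transport (λ Z → ⊢ χ ⊃ ∃' ω m (Z ∧' χm)) (sym (SuccEq≡Succ n m)) goal
    where
      X = succName n m
      χm = subst ω n (var m) χ
      Goal = χ ⊃ ∃' ω m (Succ n m X ∧' χm)
      v = suc (maxF Goal ⊔ X)
      χv = subst ω n (var v) χ
      oχv = typed-subst {ω} {n} {χ} (var v) oχ
      Goal<v : maxF Goal < v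
      Goal<v = s≤s (m≤m⊔n _ _)
      X<v : X < v
      X<v = s≤s (m≤n⊔m _ _)
      χ<v : maxF χ < v
      χ<v = ≤-<-trans (m≤m⊔n (maxF χ) _) Goal<v
      n<X : n < X
      n<X = s≤s (≤-trans (m≤m⊔n n 0) (m≤m⊔n (n ⊔ 0) m))
      m<X : m < X
      m<X = s≤s (m≤n⊔m (n ⊔ 0) m)
      ≢v : ∀ {j} → j < v → v ≢ j
      ≢v j<v e = <⇒≢ j<v (sym e)
      k+1<v : suc k < v
      k+1<v = <-trans (transport (suc k <_) (sym X≡2+k) (n<1+n (suc k))) X<v
      v-witness : ⊢ ∃' ω v (Succ n v X)
      v-witness = transport (λ Z → ⊢ ∃' ω v (Succ n v Z)) (sym X≡2+k)
                    (Succ-exists k n v (≢v (<-trans (n<1+n k) k+1<v)) (≢v k+1<v) (≢v (<-trans n<X X<v)))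
      g = ε ▸ typed {Succ n v X} tt ▸ oχ
      ¬¬χv : ⊢ ε ▸ Succ n v X ▸ χ ⇛ ¬' ¬' ¬' ¬' χv
      ¬¬χv = use₂ g (¬¬-⊃ (typed tt) (¬¬⁺ oχv))
               (use g (¬¬-mono (transfer-to-successor f χ n m v X (suc (maxF χ)) (n<1+n _) n≢m (≢v (<-trans m<X X<v))
                                  m∉χ m-free (freeFor-fresh ω n v χ χ<v) oχ refl))
                      (use g premise (hyp g (# 0))))
               (use g (¬¬-intro (typed tt)) (hyp g (# 1)))
      witness-v : ⊢ Succ n v X ∧' χv ⊃ ∃' ω m (Succ n m X ∧' χm)
      witness-v = transport (λ Z → ⊢ Z ⊃ ∃' ω m (Succ n m X ∧' χm))
                    (cong₂ _∧'_ Succ-renamed (subst-trans ω n m (var v) χ m∉χ m-free))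
                    (∃-intro (var v) (Equivalence.from T-≡ (freeFor-fresh ω m v (Succ n m X ∧' χm)
                               (≤-<-trans (≤-trans (m≤n⊔m m _) (m≤n⊔m (maxF χ) _)) Goal<v)))
                             (∃⁺ tt (∧⁺ (typed tt) (typed-subst (var m) oχ))))
        where Succ-renamed : subst ω m (var v) (Succ n m X) ≡ Succ n v X
              Succ-renamed rewrite ≢⇒≡ᵇ-false (λ e → n≢m (sym e)) | ≡ᵇ-refl m = refl
      goal : ⊢ Goal
      goal = mp v-witness (∃-elim (notFree (isFree-fresh ω v Goal Goal<v)) tt
               (use g witness-v (∧-intro g (hyp g (# 1)) (use g (stable v) (use g (¬¬-idem oχv) ¬¬χv)))))

below-suc-max : ∀ xs → All (_< suc (foldr _⊔_ 0 xs)) xs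
below-suc-max [] = []
below-suc-max (x ∷ xs) =
  s≤s (m≤m⊔n x _) ∷ All.map (λ lt → ≤-trans lt (s≤s (m≤n⊔m x _))) (below-suc-max xs)

module Soundness (G : GodelNumbering) (s : ℕ) where
  open BT G
  open Translation G
  open Derivations G s
  open Intuitionistic G s
  open AxiomTranslation G s
  open Induction G s

  fuel : Formula → ℕ
  fuel A = suc (foldr _⊔_ 0 (constsF A))

  fuel-bound : ∀ A → FuelBound (fuel A) A
  fuel-bound A = below-suc-max (constsF A)

  refuel : ∀ {f g} A → FuelBound f A → FuelBound g A → ⊢ negF f A → ⊢ negF g A
  refuel A bf bg = transport ⊢_ (negF-fuel _ _ A bf bg)

  translation : ∀ {A} → Prov cl s A → ⊢ neg A
  translation (ax {A} a o) = axiom-translation _ (fuel-bound A) a (typed o)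
  translation (mp {φ} {ψ} p q) =
    refuel ψ (++⁻ʳ (constsF φ) bq) (fuel-bound ψ)
      (mp (refuel φ (fuel-bound φ) (++⁻ˡ (constsF φ) bq) (translation p)) (translation q))
    where bq = fuel-bound (φ ⊃ ψ)
  translation (gen∀ φ ψ r i nf o p) =
    ∀-gen (notFree (trans (negF-isFree _ r i φ) (Equivalence.to T-not-≡ nf))) (T-∧⁻ˡ (T-∧⁻ʳ {typesOK s φ} o))
          (translation p)
  translation (gen∃ φ ψ r i nf o p) =
    ⊃-trans (¬¬-mono (∃-elim (notFree (trans (negF-isFree _ r i ψ) (Equivalence.to T-not-≡ nf)))
                             (T-∧⁻ˡ (T-∧⁻ˡ {tyOK s r ∧ typesOK s φ} o)) (translation p)))
            (negF-stable _ ψ (⊃⁻ʳ (typed-⊢ p)))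
  translation (ind φ n m nf ff p q) with n ≟ m
  -- for n = m the side condition says n is not free in φ, so the base case is φ itself
  ... | yes refl = transport (λ z → ⊢ neg z) (subst-notFree ω n zer φ (Equivalence.to T-not-≡ nf)) (translation p)
  ... | no n≢m = ind (negF F φ) n m (transport (λ z → T (not z)) (sym (negF-isFree F ω m φ)) nf) (Equivalence.from T-≡ m-free)
                   base (induction-step F (negF F φ) n m n≢m m∉φ⁻ m-free (typed-negF (⊃⁻ˡ (typed-⊢ q))) stable step)
    where
      F = fuel φ
      bφ = fuel-bound φ
      same-consts : ∀ t → constsT t ≡ [] → constsF (subst ω n t φ) ≡ constsF φ
      same-consts t h = constsF-subst ω n t φ h
      base : ⊢ subst ω n zer (negF F φ)
      base = transport ⊢_ (negF-subst F ω n zer φ)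
               (transport (λ l → ⊢ negF (suc (foldr _⊔_ 0 l)) (subst ω n zer φ)) (same-consts zer refl) (translation p))
      Step = φ ⊃ ∃' ω m (SuccEq n m ∧' subst ω n (var m) φ)
      step : ⊢ negF F φ ⊃ ¬' ¬' ∃' ω m (negF F (SuccEq n m) ∧' subst ω n (var m) (negF F φ))
      step = transport (λ Z → ⊢ negF F φ ⊃ ¬' ¬' ∃' ω m (negF F (SuccEq n m) ∧' Z)) (negF-subst F ω n (var m) φ)
               (refuel Step (fuel-bound Step) (++⁺ bφ (transport (All (_< F)) (sym (same-consts (var m) refl)) bφ)) (translation q))
      m∉φ⁻ = trans (negF-isFree F ω m φ) (Equivalence.to T-not-≡ nf)
      m-free = trans (negF-freeFor F ω n (var m) φ) (Equivalence.to T-≡ ff)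
      stable : ∀ v → ⊢ ¬' ¬' subst ω n (var v) (negF F φ) ⊃ subst ω n (var v) (negF F φ)
      stable v = transport (λ Z → ⊢ ¬' ¬' Z ⊃ Z) (negF-subst F ω n (var v) φ)
                   (negF-stable F (subst ω n (var v) φ) (typed-subst (var v) (⊃⁻ˡ (typed-⊢ q))))

theorem9 : (G : GodelNumbering) (s : ℕ) (ψ : Formula) →
    T (typesOK s ψ) →
    BT.Prov G cl s ψ →
    BT.Prov G int s (BT.neg G ψ)
theorem9 G s ψ _ = Soundness.translation G s
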